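{- Let $q\ge2$ and $r\in\{0,1,\dots,q-1\}$ be integers and let $p>q+r$ be an integer. Let $A=\{d\in\{0,1,\dots,p-1\}: d\equiv r \pmod q\}$, $s=\#A$ (so $s\ge 2$ and $h(i)=qi+r$ for $0\le i\le s-1$). Then \[ m=\inf_{n\ge1}b_n=\frac{q(s-1)+r}{p-1},\qquad M=\sup_{n\ge1}b_n=\frac{q(p-1)+pr}{p-1}. \]
   Context: For integers $p> s\ge 2$ and $A\subset\{0,\dots,p-1\}$ with $\#A=s$, let $h:\{0,\dots,s-1\}\to A$ be the strictly increasing bijection. For a positive integer $n$ with base-$s$ expansion $n=\sum_{i=0}^k\varepsilon_i s^i$ ($\varepsilon_k\ne0$), put $a_n=\sum_{i=0}^k h(\varepsilon_i)p^i$ and $b_n=a_n/n^{\log_s p}$. -}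

module Defs where

open import Algebra.Bundles using (CommutativeRing)
import Algebra.Properties.Semiring.Sum as Sum
open import Data.Bool using (true)
open import Data.Empty using (⊥; ⊥-elim)
open import Data.Fin as Fin using (Fin; zero; suc; toℕ)
import Data.Fin.Properties as Fin
open import Data.Fin.Subset using (Subset; inside; outside; ∣_∣; _∈_)
open import Data.Fin.Subset.Properties using (∣p∣≤n; x∈p⇒∣p-x∣<∣p∣; x∈p∧x≢y⇒x∈p-y)
open import Data.Integer as ℤ using (ℤ; +_; -[1+_])
import Data.Integer.Properties as ℤ
import Data.Integer.Solver as ℤSolver
open import Data.Nat as ℕ using (ℕ; zero; suc)
open import Data.Nat.Divisibility using (_∣_; _∣?_; divides; n∣m*n; ∣⇒≤)
import Data.Nat.DivMod as ℕ
open import Data.Nat.Induction using (<-rec)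
import Data.Nat.Properties as ℕ
open import Data.Product using (Σ; ∃; _×_; _,_; proj₁; proj₂)
open import Data.Rational.Unnormalised hiding (∣_∣)
import Data.Rational.Unnormalised.Properties as ℚ
import Data.Rational.Unnormalised.Solver as ℚSolver
open import Data.Sum using (_⊎_; inj₁; inj₂)
open import Data.Vec using (_∷_; tabulate; here; there)
open import Data.Vec.Properties using (lookup∘tabulate; []=⇒lookup; lookup⇒[]=)
open import Relation.Binary using (tri<; tri≈; tri>)
open import Relation.Binary.PropositionalEquality using (_≡_; _≢_; refl; sym; trans; cong; cong₂; subst; subst₂)
open import Relation.Nullary using (¬_; yes; no; does; contradiction)
open import Relation.Nullary.Decidable using (dec-true)
open import Algebra.Properties.CommutativeSemiring.Exp (CommutativeRing.commutativeSemiring ℚ.+-*-commutativeRing)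
  using (_^_; ^-homo-*; ^-assocʳ; ^-distrib-*)

record ℝ : Set₁ where
  field
    L U       : ℚᵘ → Set
    L-inhab   : ∃ L
    U-inhab   : ∃ U
    L-rounded : ∀ {q} → L q → ∃ λ r → q < r × L r
    U-rounded : ∀ {q} → U q → ∃ λ r → r < q × U r
    disjoint  : ∀ {q} → L q → U q → ⊥
    located   : ∀ {q r} → q < r → L q ⊎ U r

  L-down : ∀ {q r} → q < r → L r → L q
  L-down q<r Lr with located q<r
  ... | inj₁ Lq = Lq
  ... | inj₂ Ur = ⊥-elim (disjoint Lr Ur)

  U-up : ∀ {q r} → q < r → U q → U r
  U-up q<r Uq with located q<r
  ... | inj₁ Lq = ⊥-elim (disjoint Lq Uq)
  ... | inj₂ Ur = Ur

  U-up-≤ : ∀ {q r} → q ≤ r → U q → U r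
  U-up-≤ q≤r Uq with U-rounded Uq
  ... | _ , t<q , Ut = U-up (ℚ.<-≤-trans t<q q≤r) Ut

  L-down-≤ : ∀ {q r} → q ≤ r → L r → L q
  L-down-≤ q≤r Lr with L-rounded Lr
  ... | _ , r<t , Lt = L-down (ℚ.≤-<-trans q≤r r<t) Lt

  L<U : ∀ {q r} → L q → U r → q < r
  L<U {q} {r} Lq Ur with ℚ.≤-total r q
  ... | inj₁ r≤q = ⊥-elim (disjoint Lq (U-up-≤ r≤q Ur))
  ... | inj₂ q≤r with ℚ.<-cmp q r
  ...   | tri< q<r _ _ = q<r
  ...   | tri≈ _ q≃r _ = ⊥-elim (disjoint Lq (U-up-≤ (ℚ.≤-reflexive (ℚ.≃-sym q≃r)) Ur))
  ...   | tri> _ _ r<q = ⊥-elim (disjoint Lq (U-up r<q Ur))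

open ℝ

infix 4 _<ᴿ_ _≤ᴿ_ _≃ᴿ_

_<ᴿ_ _≤ᴿ_ _≃ᴿ_ : ℝ → ℝ → Set
x <ᴿ y = ∃ λ q → U x q × L y q
x ≤ᴿ y = ¬ (y <ᴿ x)
x ≃ᴿ y = x ≤ᴿ y × y ≤ᴿ x

fromℚ : ℚᵘ → ℝ
fromℚ x = record
  { L         = _< x
  ; U         = x <_
  ; L-inhab   = x - 1ℚᵘ , ℚ.<-respʳ-≃ (ℚ.+-identityʳ x) (ℚ.+-monoʳ-< x (*<* ℤ.-<+))
  ; U-inhab   = x + 1ℚᵘ , ℚ.<-respˡ-≃ (ℚ.+-identityʳ x) (ℚ.+-monoʳ-< x (*<* (ℤ.+<+ (ℕ.s≤s ℕ.z≤n))))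
  ; L-rounded = λ q<x → let (m , q<m , m<x) = ℚ.<-dense q<x in m , q<m , m<x
  ; U-rounded = λ x<q → let (m , x<m , m<q) = ℚ.<-dense x<q in m , m<q , x<m
  ; disjoint  = ℚ.<-asym
  ; located   = loc
  }
  where
  loc : ∀ {q r} → q < r → q < x ⊎ x < r
  loc {q} q<r with q ℚ.<? x
  ... | yes q<x = inj₁ q<x
  ... | no  q≮x = inj₂ (ℚ.≤-<-trans (ℚ.≮⇒≥ q≮x) q<r)

fromℕ : ℕ → ℝ
fromℕ n = fromℚ (+ n / 1)

-- The second component is the constructive form of "every x > m is not a lower
-- bound"; it implies that every lower bound is ≤ m.
IsInfimum : {I : Set} → (I → ℝ) → ℝ → Set₁
IsInfimum f m = (∀ i → m ≤ᴿ f i) × (∀ x → m <ᴿ x → ∃ λ i → f i <ᴿ x)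

IsSupremum : {I : Set} → (I → ℝ) → ℝ → Set₁
IsSupremum f M = (∀ i → f i ≤ᴿ M) × (∀ x → x <ᴿ M → ∃ λ i → x <ᴿ f i)

*-mono : ∀ {p q r s} → 0ℚᵘ ≤ p → 0ℚᵘ ≤ r → p ≤ q → r ≤ s → p * r ≤ q * s
*-mono 0≤p 0≤r = ℚ.*-mono-≤-nonNeg {{nonNegative 0≤p}} {{nonNegative 0≤r}}

*-monoˡ : ∀ {p q} r → 0ℚᵘ ≤ r → p ≤ q → p * r ≤ q * r
*-monoˡ r 0≤r = ℚ.*-monoˡ-≤-nonNeg r {{nonNegative 0≤r}}

*-monoʳ : ∀ {p q} r → 0ℚᵘ ≤ r → p ≤ q → r * p ≤ r * q
*-monoʳ r 0≤r = ℚ.*-monoʳ-≤-nonNeg r {{nonNegative 0≤r}}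

*-monoˡ-< : ∀ {p q} r → 0ℚᵘ < r → p < q → p * r < q * r
*-monoˡ-< r 0<r = ℚ.*-monoˡ-<-pos r {{positive 0<r}}

*-monoʳ-< : ∀ {p q} r → 0ℚᵘ < r → p < q → r * p < r * q
*-monoʳ-< r 0<r = ℚ.*-monoʳ-<-pos r {{positive 0<r}}

*-pos : ∀ {p q} → 0ℚᵘ < p → 0ℚᵘ < q → 0ℚᵘ < p * q
*-pos {p} {q} 0<p 0<q = ℚ.<-respˡ-≃ (ℚ.*-zeroˡ q) (*-monoˡ-< q 0<q 0<p)

*-nonNeg : ∀ {p q} → 0ℚᵘ ≤ p → 0ℚᵘ ≤ q → 0ℚᵘ ≤ p * q
*-nonNeg {p} {q} 0≤p 0≤q = ℚ.≤-respˡ-≃ (ℚ.*-zeroˡ q) (*-monoˡ q 0≤q 0≤p)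

0<1 : 0ℚᵘ < 1ℚᵘ
0<1 = *<* (ℤ.+<+ (ℕ.s≤s ℕ.z≤n))

0≤ι : ∀ n → 0ℚᵘ ≤ + n / 1
0≤ι n = *≤* (subst (ℤ._≤ + n ℤ.* + 1) (sym (ℤ.*-zeroˡ (+ 1))) (subst (+ 0 ℤ.≤_) (sym (ℤ.*-identityʳ (+ n))) (ℤ.+≤+ ℕ.z≤n)))

ι-mono : ∀ {m n} → m ℕ.≤ n → + m / 1 ≤ + n / 1
ι-mono {m} {n} m≤n = *≤* (subst₂ ℤ._≤_ (sym (ℤ.*-identityʳ (+ m))) (sym (ℤ.*-identityʳ (+ n))) (ℤ.+≤+ m≤n))

ι-mono-< : ∀ {m n} → m ℕ.< n → + m / 1 < + n / 1
ι-mono-< {m} {n} m<n = *<* (subst₂ ℤ._<_ (sym (ℤ.*-identityʳ (+ m))) (sym (ℤ.*-identityʳ (+ n))) (ℤ.+<+ m<n))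

*-≃ˡ : ∀ {p q} r → p ≃ q → p * r ≃ q * r
*-≃ˡ {p} {q} r p≃q = ℚ.*-cong {p} {q} {r} {r} p≃q ℚ.≃-refl

*-≃ʳ : ∀ {p q} r → p ≃ q → r * p ≃ r * q
*-≃ʳ {p} {q} r p≃q = ℚ.*-cong {r} {r} {p} {q} ℚ.≃-refl p≃q

^-pos : ∀ {x} n → 0ℚᵘ < x → 0ℚᵘ < x ^ n
^-pos zero    0<x = 0<1
^-pos (suc n) 0<x = *-pos 0<x (^-pos n 0<x)

^-nonNeg : ∀ {x} n → 0ℚᵘ ≤ x → 0ℚᵘ ≤ x ^ n
^-nonNeg zero    0≤x = ℚ.<⇒≤ 0<1
^-nonNeg (suc n) 0≤x = *-nonNeg 0≤x (^-nonNeg n 0≤x)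

^-monoˡ : ∀ {x y} n → 0ℚᵘ ≤ x → x ≤ y → x ^ n ≤ y ^ n
^-monoˡ zero    0≤x x≤y = ℚ.≤-refl
^-monoˡ (suc n) 0≤x x≤y = *-mono 0≤x (^-nonNeg n 0≤x) x≤y (^-monoˡ n 0≤x x≤y)

^-monoˡ-< : ∀ {x y} n → 0ℚᵘ ≤ x → x < y → x ^ suc n < y ^ suc n
^-monoˡ-< {x} {y} n 0≤x x<y = ℚ.≤-<-trans
  (*-monoʳ x 0≤x (^-monoˡ n 0≤x (ℚ.<⇒≤ x<y)))
  (*-monoˡ-< (y ^ n) (^-pos n (ℚ.≤-<-trans 0≤x x<y)) x<y)

1≤^ : ∀ {x} n → 1ℚᵘ ≤ x → 1ℚᵘ ≤ x ^ n
1≤^ zero    1≤x = ℚ.≤-refl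
1≤^ (suc n) 1≤x = ℚ.≤-respˡ-≃ (ℚ.*-identityˡ 1ℚᵘ) (*-mono (ℚ.<⇒≤ 0<1) (ℚ.<⇒≤ 0<1) 1≤x (1≤^ n 1≤x))

^-monoʳ : ∀ {x m n} → 1ℚᵘ ≤ x → m ℕ.≤ n → x ^ m ≤ x ^ n
^-monoʳ {n = n} 1≤x ℕ.z≤n       = 1≤^ n 1≤x
^-monoʳ {x}     1≤x (ℕ.s≤s m≤n) = *-monoʳ x (ℚ.≤-trans (ℚ.<⇒≤ 0<1) 1≤x) (^-monoʳ 1≤x m≤n)

^-monoʳ-< : ∀ {x m n} → 1ℚᵘ < x → m ℕ.< n → x ^ m < x ^ n
^-monoʳ-< {x} {m} {n} 1<x m<n = ℚ.<-≤-trans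
  (ℚ.<-respˡ-≃ (ℚ.*-identityˡ (x ^ m)) (*-monoˡ-< (x ^ m) (^-pos m (ℚ.<-trans 0<1 1<x)) 1<x))
  (^-monoʳ (ℚ.<⇒≤ 1<x) m<n)

x≤x^suc : ∀ {x} n → 1ℚᵘ ≤ x → x ≤ x ^ suc n
x≤x^suc {x} n 1≤x = ℚ.≤-respˡ-≃ (ℚ.*-identityʳ x) (*-monoʳ x (ℚ.≤-trans (ℚ.<⇒≤ 0<1) 1≤x) (1≤^ n 1≤x))

^suc≤x : ∀ {x} n → 0ℚᵘ ≤ x → x ≤ 1ℚᵘ → x ^ suc n ≤ x
^suc≤x {x} n 0≤x x≤1 = ℚ.≤-respʳ-≃ (ℚ.*-identityʳ x)
  (*-monoʳ x 0≤x (ℚ.≤-respʳ-≃ (ℚ.≃-reflexive (1^ n)) (^-monoˡ n 0≤x x≤1)))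
  where
  1^ : ∀ n → 1ℚᵘ ^ n ≡ 1ℚᵘ
  1^ zero    = refl
  1^ (suc n) rewrite 1^ n = refl

bernoulli : ∀ δ n → 0ℚᵘ ≤ δ → 1ℚᵘ + (+ n / 1) * δ ≤ (1ℚᵘ + δ) ^ n
bernoulli δ zero    0≤δ = ℚ.≤-reflexive (solve 1 (λ δ → con 1ℚᵘ :+ con 0ℚᵘ :* δ := con 1ℚᵘ) ℚ.≃-refl δ)
  where open ℚSolver.+-*-Solver
bernoulli δ (suc n) 0≤δ = begin
  1ℚᵘ + (+ suc n / 1) * δ                          ≃⟨ ℚ.+-congʳ 1ℚᵘ (*-≃ˡ δ suc-ι) ⟩
  1ℚᵘ + (1ℚᵘ + ν) * δ                              ≃⟨ solve 2 (λ ν δ → con 1ℚᵘ :+ (con 1ℚᵘ :+ ν) :* δ := con 1ℚᵘ :+ (con 1ℚᵘ :+ ν) :* δ :+ con 0ℚᵘ) ℚ.≃-refl ν δ ⟩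
  1ℚᵘ + (1ℚᵘ + ν) * δ + 0ℚᵘ                        ≤⟨ ℚ.+-monoʳ-≤ (1ℚᵘ + (1ℚᵘ + ν) * δ) (*-nonNeg 0≤δ (*-nonNeg (0≤ι n) 0≤δ)) ⟩
  1ℚᵘ + (1ℚᵘ + ν) * δ + δ * (ν * δ)                ≃⟨ solve 2 (λ ν δ → con 1ℚᵘ :+ (con 1ℚᵘ :+ ν) :* δ :+ δ :* (ν :* δ) := (con 1ℚᵘ :+ δ) :* (con 1ℚᵘ :+ ν :* δ)) ℚ.≃-refl ν δ ⟩
  (1ℚᵘ + δ) * (1ℚᵘ + ν * δ)                        ≤⟨ *-monoʳ (1ℚᵘ + δ) 0≤1+δ (bernoulli δ n 0≤δ) ⟩
  (1ℚᵘ + δ) * (1ℚᵘ + δ) ^ n                        ∎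
  where
  open ℚ.≤-Reasoning
  open ℚSolver.+-*-Solver
  ν = + n / 1
  suc-ι : + suc n / 1 ≃ 1ℚᵘ + ν
  suc-ι = *≡* (cong (λ k → (+ 1 ℤ.+ k) ℤ.* + 1) (sym (ℤ.*-identityʳ (+ n))))
  0≤1+δ : 0ℚᵘ ≤ 1ℚᵘ + δ
  0≤1+δ = ℚ.≤-respˡ-≃ (ℚ.+-identityˡ 0ℚᵘ) (ℚ.+-mono-≤ (ℚ.<⇒≤ 0<1) 0≤δ)

n≤b^n : ∀ b n → 2 ℕ.≤ b → + n / 1 ≤ (+ b / 1) ^ n
n≤b^n b n 2≤b = begin
  ν                     ≃⟨ solve 1 (λ ν → ν := con 0ℚᵘ :+ ν :* con 1ℚᵘ) ℚ.≃-refl ν ⟩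
  0ℚᵘ + ν * 1ℚᵘ         ≤⟨ ℚ.+-monoˡ-≤ (ν * 1ℚᵘ) (ℚ.<⇒≤ 0<1) ⟩
  1ℚᵘ + ν * 1ℚᵘ         ≤⟨ bernoulli 1ℚᵘ n (ℚ.<⇒≤ 0<1) ⟩
  (1ℚᵘ + 1ℚᵘ) ^ n       ≤⟨ ^-monoˡ n (0≤ι 2) (ι-mono 2≤b) ⟩
  (+ b / 1) ^ n         ∎
  where
  open ℚ.≤-Reasoning
  open ℚSolver.+-*-Solver
  ν = + n / 1

∃-pow-≥ : ∀ k {δ} → 0ℚᵘ < δ → ∃ λ n → + k / 1 ≤ (1ℚᵘ + δ) ^ suc n
∃-pow-≥ k {δ@(mkℚᵘ a d)} 0<δ = N , (begin
  κ                             ≤⟨ k≤Nδ a 0<δ ⟩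
  (+ suc N / 1) * δ             ≃⟨ ℚ.≃-sym (ℚ.+-identityˡ ((+ suc N / 1) * δ)) ⟩
  0ℚᵘ + (+ suc N / 1) * δ       ≤⟨ ℚ.+-monoˡ-≤ ((+ suc N / 1) * δ) (ℚ.<⇒≤ 0<1) ⟩
  1ℚᵘ + (+ suc N / 1) * δ       ≤⟨ bernoulli δ (suc N) (ℚ.<⇒≤ 0<δ) ⟩
  (1ℚᵘ + δ) ^ suc N             ∎)
  where
  open ℚ.≤-Reasoning
  κ = + k / 1
  N = k ℕ.* suc d
  k≤Nδ : ∀ a → 0ℚᵘ < mkℚᵘ a d → κ ≤ (+ suc N / 1) * mkℚᵘ a d
  k≤Nδ (+ zero)  0<δ = ⊥-elim (ℚ.<-irrefl (*≡* refl) 0<δ)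
  k≤Nδ (+ suc a) 0<δ = *≤* (subst (ℤ._≤ (+ suc N ℤ.* + suc a) ℤ.* + 1) (ℤ.pos-* k _) (ℤ.+≤+ (ℕ.≤-trans
    (ℕ.≤-reflexive (cong (k ℕ.*_) (ℕ.+-identityʳ (suc d))))
    (ℕ.≤-trans (ℕ.n≤1+n N) (ℕ.≤-trans (ℕ.m≤m*n (suc N) (suc a)) (ℕ.≤-reflexive (sym (ℕ.*-identityʳ _))))))))
  k≤Nδ -[1+ a ]  (*<* ())

infixl 15 _⁺ _⁻

_⁺ _⁻ : ℤ → ℕ
(+ n)    ⁺ = n
-[1+ n ] ⁺ = 0
(+ n)    ⁻ = 0
-[1+ n ] ⁻ = suc n

infix 4 _≤_^ʳ_ _^ʳ_≤_

-- With v = c/d and c = c⁺ - c⁻, for y > 0 the inequality y ≤ b^v is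
-- y^d b^(c⁻) ≤ b^(c⁺).
_≤_^ʳ_ : ℚᵘ → ℕ → ℚᵘ → Set
y ≤ b ^ʳ v = y ≤ 0ℚᵘ ⊎ y ^ ↧ₙ v * (+ b / 1) ^ (↥ v ⁻) ≤ (+ b / 1) ^ (↥ v ⁺)

_^ʳ_≤_ : ℕ → ℚᵘ → ℚᵘ → Set
b ^ʳ v ≤ y = 0ℚᵘ < y × (+ b / 1) ^ (↥ v ⁺) ≤ y ^ ↧ₙ v * (+ b / 1) ^ (↥ v ⁻)

⁺-⁻ : ∀ c → c ≡ + (c ⁺) ℤ.- + (c ⁻)
⁺-⁻ (+ n)    = sym (ℤ.+-identityʳ (+ n))
⁺-⁻ -[1+ n ] = refl

module _ (v w : ℚᵘ) where
  private
    A = ↥ v ⁻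
    B = ↥ v ⁺
    C = ↥ w ⁺
    E = ↥ w ⁻
    d₁ = ↧ₙ v
    d₂ = ↧ₙ w

    low high : ℕ
    low  = B ℕ.* d₂ ℕ.+ E ℕ.* d₁
    high = A ℕ.* d₂ ℕ.+ C ℕ.* d₁

    t = + (E ℕ.* d₁ ℕ.+ A ℕ.* d₂)

    pos-+* : ∀ a b c d → + (a ℕ.* b ℕ.+ c ℕ.* d) ≡ + a ℤ.* + b ℤ.+ + c ℤ.* + d
    pos-+* a b c d = trans (ℤ.pos-+ (a ℕ.* b) (c ℕ.* d)) (cong₂ ℤ._+_ (ℤ.pos-* a b) (ℤ.pos-* c d))

    eqlow : ↥ v ℤ.* ↧ w ℤ.+ t ≡ + low
    eqlow = trans (cong₂ (λ x y → x ℤ.* ↧ w ℤ.+ y) (⁺-⁻ (↥ v)) (pos-+* E d₁ A d₂))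
      (trans (solve 5 (λ b a x e y → (b :- a) :* x :+ (e :* y :+ a :* x) := b :* x :+ e :* y) refl
               (+ B) (+ A) (↧ w) (+ E) (↧ v))
        (sym (pos-+* B d₂ E d₁)))
      where open ℤSolver.+-*-Solver

    eqhigh : ↥ w ℤ.* ↧ v ℤ.+ t ≡ + high
    eqhigh = trans (cong₂ (λ x y → x ℤ.* ↧ v ℤ.+ y) (⁺-⁻ (↥ w)) (pos-+* E d₁ A d₂))
      (trans (solve 5 (λ c e y a x → (c :- e) :* y :+ (e :* y :+ a :* x) := a :* x :+ c :* y) refl
               (+ C) (+ E) (↧ v) (+ A) (↧ w))
        (sym (pos-+* A d₂ C d₁)))
      where open ℤSolver.+-*-Solver

    low≤high : v ≤ w → low ℕ.≤ high
    low≤high (*≤* v≤w) = ℤ.drop‿+≤+ (subst₂ ℤ._≤_ eqlow eqhigh (ℤ.+-monoˡ-≤ t v≤w))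

    low<high : v < w → low ℕ.< high
    low<high (*<* v<w) = ℤ.drop‿+<+ (subst₂ ℤ._<_ eqlow eqhigh (ℤ.+-monoˡ-< t v<w))

    combine : ∀ {β y z} → 0ℚᵘ < β → 0ℚᵘ < y → 0ℚᵘ < z →
              y ^ d₁ * β ^ A ≤ β ^ B → β ^ C ≤ z ^ d₂ * β ^ E →
              y ^ (d₁ ℕ.* d₂) * β ^ high ≤ z ^ (d₁ ℕ.* d₂) * β ^ low
    combine {β} {y} {z} 0<β 0<y 0<z h₁ h₂ = begin
      y ^ (d₁ ℕ.* d₂) * β ^ high
        ≃⟨ ℚ.*-cong (ℚ.≃-sym (^-assocʳ y d₁ d₂))
             (ℚ.≃-trans (^-homo-* β (A ℕ.* d₂) (C ℕ.* d₁))
               (ℚ.*-cong (ℚ.≃-sym (^-assocʳ β A d₂)) (ℚ.≃-sym (^-assocʳ β C d₁)))) ⟩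
      (y ^ d₁) ^ d₂ * ((β ^ A) ^ d₂ * (β ^ C) ^ d₁)
        ≃⟨ ℚ.≃-sym (ℚ.*-assoc ((y ^ d₁) ^ d₂) ((β ^ A) ^ d₂) ((β ^ C) ^ d₁)) ⟩
      (y ^ d₁) ^ d₂ * (β ^ A) ^ d₂ * (β ^ C) ^ d₁
        ≃⟨ *-≃ˡ ((β ^ C) ^ d₁) (ℚ.≃-sym (^-distrib-* (y ^ d₁) (β ^ A) d₂)) ⟩
      (y ^ d₁ * β ^ A) ^ d₂ * (β ^ C) ^ d₁
        ≤⟨ *-mono (^-nonNeg d₂ (ℚ.<⇒≤ (*-pos (^-pos d₁ 0<y) (^-pos A 0<β))))
                  (^-nonNeg d₁ (ℚ.<⇒≤ (^-pos C 0<β)))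
                  (^-monoˡ d₂ (ℚ.<⇒≤ (*-pos (^-pos d₁ 0<y) (^-pos A 0<β))) h₁)
                  (^-monoˡ d₁ (ℚ.<⇒≤ (^-pos C 0<β)) h₂) ⟩
      (β ^ B) ^ d₂ * (z ^ d₂ * β ^ E) ^ d₁
        ≃⟨ *-≃ʳ ((β ^ B) ^ d₂) (^-distrib-* (z ^ d₂) (β ^ E) d₁) ⟩
      (β ^ B) ^ d₂ * ((z ^ d₂) ^ d₁ * (β ^ E) ^ d₁)
        ≃⟨ solve 3 (λ a b c → a :* (b :* c) := b :* (a :* c)) ℚ.≃-refl ((β ^ B) ^ d₂) ((z ^ d₂) ^ d₁) ((β ^ E) ^ d₁) ⟩
      (z ^ d₂) ^ d₁ * ((β ^ B) ^ d₂ * (β ^ E) ^ d₁)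
        ≃⟨ ℚ.*-cong (ℚ.≃-trans (^-assocʳ z d₂ d₁) (ℚ.≃-reflexive (cong (z ^_) (ℕ.*-comm d₂ d₁))))
             (ℚ.≃-trans (ℚ.*-cong (^-assocʳ β B d₂) (^-assocʳ β E d₁))
               (ℚ.≃-sym (^-homo-* β (B ℕ.* d₂) (E ℕ.* d₁)))) ⟩
      z ^ (d₁ ℕ.* d₂) * β ^ low ∎
      where
      open ℚ.≤-Reasoning
      open ℚSolver.+-*-Solver

    0<ι : ∀ {b} → 1 ℕ.≤ b → 0ℚᵘ < + b / 1
    0<ι 1≤b = ℚ.<-≤-trans 0<1 (ι-mono 1≤b)

  ^ʳ-mono : ∀ {b y z} → 1 ℕ.≤ b → v ≤ w → y ≤ b ^ʳ v → b ^ʳ w ≤ z → y ≤ z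
  ^ʳ-mono {b} {y} {z} 1≤b v≤w (inj₁ y≤0) (0<z , h₂) = ℚ.≤-trans y≤0 (ℚ.<⇒≤ 0<z)
  ^ʳ-mono {b} {y} {z} 1≤b v≤w (inj₂ h₁)  (0<z , h₂) = ℚ.≮⇒≥ λ z<y →
    ℚ.<-irrefl ℚ.≃-refl (begin-strict
      z ^ D * β ^ low    ≤⟨ *-monoʳ (z ^ D) (^-nonNeg D (ℚ.<⇒≤ 0<z)) (^-monoʳ (ι-mono 1≤b) (low≤high v≤w)) ⟩
      z ^ D * β ^ high   <⟨ *-monoˡ-< (β ^ high) (^-pos high (0<ι 1≤b)) (^-monoˡ-< {z} {y} (ℕ.pred D) (ℚ.<⇒≤ 0<z) z<y) ⟩
      y ^ D * β ^ high   ≤⟨ combine (0<ι 1≤b) (ℚ.<-trans 0<z z<y) 0<z h₁ h₂ ⟩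
      z ^ D * β ^ low    ∎)
    where
    open ℚ.≤-Reasoning
    β = + b / 1
    D = d₁ ℕ.* d₂

  ^ʳ-mono-< : ∀ {b y} → 2 ℕ.≤ b → v < w → 0ℚᵘ < y → y ≤ b ^ʳ v → b ^ʳ w ≤ y → ⊥
  ^ʳ-mono-< 2≤b v<w 0<y (inj₁ y≤0) _ = ℚ.<-irrefl ℚ.≃-refl (ℚ.<-≤-trans 0<y y≤0)
  ^ʳ-mono-< {b} {y} 2≤b v<w 0<y (inj₂ h₁) (_ , h₂) =
    ℚ.<-irrefl ℚ.≃-refl (begin-strict
      y ^ D * β ^ low    <⟨ *-monoʳ-< (y ^ D) (^-pos D 0<y) (^-monoʳ-< (ι-mono-< 2≤b) (low<high v<w)) ⟩
      y ^ D * β ^ high   ≤⟨ combine (0<ι (ℕ.≤-trans (ℕ.n≤1+n 1) 2≤b)) 0<y 0<y h₁ h₂ ⟩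
      y ^ D * β ^ low    ∎)
    where
    open ℚ.≤-Reasoning
    β = + b / 1
    D = d₁ ℕ.* d₂

^ʳ-total : ∀ b v {y} → 0ℚᵘ < y → (y ≤ b ^ʳ v) ⊎ (b ^ʳ v ≤ y)
^ʳ-total b v {y} 0<y with ℚ.≤-total (y ^ ↧ₙ v * (+ b / 1) ^ (↥ v ⁻)) ((+ b / 1) ^ (↥ v ⁺))
... | inj₁ le = inj₁ (inj₂ le)
... | inj₂ ge = inj₂ (0<y , ge)

-- log_b x = sup {v : b^v ≤ x} = inf {v : x ≤ b^v}
module _ (b x : ℕ) (2≤b : 2 ℕ.≤ b) (1≤x : 1 ℕ.≤ x) where
  private
    ξ = + x / 1

    0<ξ : 0ℚᵘ < ξ
    0<ξ = ℚ.<-≤-trans 0<1 (ι-mono 1≤x)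

  log : ℝ
  log = record
    { L         = λ q → ∃ λ v → q < v × (b ^ʳ v ≤ ξ)
    ; U         = λ q → ∃ λ v → v < q × (ξ ≤ b ^ʳ v)
    ; L-inhab   = - 1ℚᵘ , 0ℚᵘ , *<* ℤ.-<+ , 0<ξ , ℚ.≤-trans (ι-mono 1≤x) (ℚ.≤-reflexive (ℚ.≃-sym ξ-simp))
    ; U-inhab   = + suc x / 1 , ξ , ι-mono-< (ℕ.n<1+n x) ,
                  inj₂ (ℚ.≤-trans (ℚ.≤-reflexive ξ-simp) (n≤b^n b x 2≤b))
    ; L-rounded = λ (v , q<v , h) → let (m , q<m , m<v) = ℚ.<-dense q<v in m , q<m , v , m<v , h
    ; U-rounded = λ (v , v<q , h) → let (m , v<m , m<q) = ℚ.<-dense v<q in m , m<q , v , v<m , h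
    ; disjoint  = λ (v , q<v , h) (w , w<q , k) → ^ʳ-mono-< w v 2≤b (ℚ.<-trans w<q q<v) 0<ξ k h
    ; located   = loc
    }
    where
    ξ-simp : ξ ^ 1 * 1ℚᵘ ≃ ξ
    ξ-simp = solve 1 (λ ξ → ξ :* con 1ℚᵘ :* con 1ℚᵘ := ξ) ℚ.≃-refl ξ
      where open ℚSolver.+-*-Solver

    loc : ∀ {q r} → q < r → (∃ λ v → q < v × (b ^ʳ v ≤ ξ)) ⊎ (∃ λ v → v < r × (ξ ≤ b ^ʳ v))
    loc q<r with ℚ.<-dense q<r
    ... | m , q<m , m<r with ^ʳ-total b m 0<ξ
    ...   | inj₁ le = inj₂ (m , m<r , le)
    ...   | inj₂ ge = inj₁ (m , q<m , ge)

hi : ∀ N q → ∃ λ k → q ≤ mkℚᵘ (+ k) N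
hi N (mkℚᵘ (+ m) d) = m ℕ.* suc N ,
  *≤* (subst₂ ℤ._≤_ (ℤ.pos-* m (suc N)) (ℤ.pos-* (m ℕ.* suc N) (suc d)) (ℤ.+≤+ (ℕ.m≤m*n (m ℕ.* suc N) (suc d))))
hi N (mkℚᵘ -[1+ m ] d) = 0 , *≤* (subst (-[1+ m ] ℤ.* + suc N ℤ.≤_) (sym (ℤ.*-zeroˡ (+ suc d))) ℤ.-≤+)

lo : ∀ N q → ∃ λ k → mkℚᵘ (ℤ.- + k) N ≤ q
lo N q with hi N (- q)
... | k , -q≤k = k , subst (mkℚᵘ (ℤ.- + k) N ≤_) (ℚ.neg-involutive-≡ q) (ℚ.neg-mono-≤ -q≤k)

grid : ∀ α N → ∃ λ c → L α (mkℚᵘ c N) × U α (mkℚᵘ (c ℤ.+ + 2) N)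
grid α N = let (l , Ll) = L-inhab α ; (u , Uu) = U-inhab α
               (a , a≤l) = lo N l ; (e , u≤e) = hi N u
           in walk (a ℕ.+ e) (ℤ.- + a) (L-down-≤ α a≤l Ll)
                (subst (λ i → U α (mkℚᵘ i N)) (sym (-a+[a+e] a e)) (U-up-≤ α u≤e Uu))
  where
  -a+[a+e] : ∀ a e → ℤ.- + a ℤ.+ + (a ℕ.+ e) ≡ + e
  -a+[a+e] a e = solve 2 (λ a e → :- a :+ (a :+ e) := e) refl (+ a) (+ e)
    where open ℤSolver.+-*-Solver

  step : ∀ c → mkℚᵘ (c ℤ.+ + 1) N < mkℚᵘ (c ℤ.+ + 2) N
  step c = *<* (ℤ.*-monoʳ-<-pos (+ suc N) (ℤ.+-monoʳ-< c (ℤ.+<+ (ℕ.n<1+n 1))))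

  walk : ∀ k c → L α (mkℚᵘ c N) → U α (mkℚᵘ (c ℤ.+ + k) N) →
         ∃ λ c → L α (mkℚᵘ c N) × U α (mkℚᵘ (c ℤ.+ + 2) N)
  walk zero    c Lc Uk = ⊥-elim (disjoint α Lc (subst (λ i → U α (mkℚᵘ i N)) (ℤ.+-identityʳ c) Uk))
  walk (suc k) c Lc Uk with located α (step c)
  ... | inj₂ U2 = c , Lc , U2
  ... | inj₁ L1 = walk k (c ℤ.+ + 1) L1 (subst (λ i → U α (mkℚᵘ i N)) (sym (ℤ.+-assoc c (+ 1) (+ k))) Uk)

[c+2]⁺+c⁻ : ∀ c → (c ℤ.+ + 2) ⁺ ℕ.+ c ⁻ ≡ 2 ℕ.+ (c ⁺ ℕ.+ (c ℤ.+ + 2) ⁻)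
[c+2]⁺+c⁻ (+ n) = cong (ℕ._+ 0) (ℕ.+-comm n 2)
[c+2]⁺+c⁻ -[1+ 0 ] = refl
[c+2]⁺+c⁻ -[1+ 1 ] = refl
[c+2]⁺+c⁻ -[1+ suc (suc m) ] = refl

-- b^α = sup {b^v : v < α} = inf {b^v : α < v}
module _ (b : ℕ) (1≤b : 1 ℕ.≤ b) (α : ℝ) where
  private
    β = + b / 1

    0<β : 0ℚᵘ < β
    0<β = ℚ.<-≤-trans 0<1 (ι-mono 1≤b)

    Lᵖ Uᵖ : ℚᵘ → Set
    Lᵖ y = ∃ λ z → y < z × ∃ λ v → L α v × (z ≤ b ^ʳ v)
    Uᵖ y = ∃ λ z → z < y × ∃ λ v → U α v × (b ^ʳ v ≤ z)

    U-inhabᵖ : ∃ Uᵖ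
    U-inhabᵖ with U-inhab α
    ... | v , Uv = Z + 1ℚᵘ , Z , ℚ.<-respˡ-≃ (ℚ.+-identityʳ Z) (ℚ.+-monoʳ-< Z 0<1) , v , Uv , ^-pos (↥ v ⁺) 0<β ,
      (begin
        Z                          ≤⟨ x≤x^suc (ℚᵘ.denominator-1 v) (1≤^ (↥ v ⁺) (ι-mono 1≤b)) ⟩
        Z ^ ↧ₙ v                   ≃⟨ ℚ.≃-sym (ℚ.*-identityʳ (Z ^ ↧ₙ v)) ⟩
        Z ^ ↧ₙ v * 1ℚᵘ             ≤⟨ *-monoʳ (Z ^ ↧ₙ v) (^-nonNeg (↧ₙ v) (ℚ.<⇒≤ (^-pos (↥ v ⁺) 0<β))) (1≤^ (↥ v ⁻) (ι-mono 1≤b)) ⟩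
        Z ^ ↧ₙ v * β ^ (↥ v ⁻)     ∎)
      where
      open ℚ.≤-Reasoning
      Z = β ^ (↥ v ⁺)

    disjointᵖ : ∀ {y} → Lᵖ y → Uᵖ y → ⊥
    disjointᵖ (z , y<z , v , Lv , h) (z′ , z′<y , w , Uw , k) =
      ℚ.<-irrefl ℚ.≃-refl (ℚ.<-≤-trans (ℚ.<-trans z′<y y<z)
        (^ʳ-mono v w 1≤b (ℚ.<⇒≤ (L<U α Lv Uw)) h k))

    shift : ∀ c N {y y′} → 0ℚᵘ < y → 0ℚᵘ < y′ → y ^ suc N * (β * β) ≤ y′ ^ suc N →
            b ^ʳ mkℚᵘ c N ≤ y → b ^ʳ mkℚᵘ (c ℤ.+ + 2) N ≤ y′
    shift c N {y} {y′} 0<y 0<y′ gap (_ , h) = 0<y′ , ℚ.*-cancelʳ-≤-pos (β ^ A) {{positive (^-pos A 0<β)}} (begin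
      β ^ P * β ^ A                   ≃⟨ ℚ.≃-sym (^-homo-* β P A) ⟩
      β ^ (P ℕ.+ A)                   ≃⟨ ℚ.≃-reflexive (cong (β ^_) ([c+2]⁺+c⁻ c)) ⟩
      β * (β * β ^ (B ℕ.+ Q))         ≃⟨ *-≃ʳ β (*-≃ʳ β (^-homo-* β B Q)) ⟩
      β * (β * (β ^ B * β ^ Q))       ≃⟨ solve 3 (λ β x y → β :* (β :* (x :* y)) := x :* (β :* β :* y)) ℚ.≃-refl β (β ^ B) (β ^ Q) ⟩
      β ^ B * (β * β * β ^ Q)         ≤⟨ *-monoˡ (β * β * β ^ Q) (ℚ.<⇒≤ (*-pos (*-pos 0<β 0<β) (^-pos Q 0<β))) h ⟩
      Y * β ^ A * (β * β * β ^ Q)     ≃⟨ solve 4 (λ y a β q → y :* a :* (β :* β :* q) := y :* (β :* β) :* (q :* a)) ℚ.≃-refl Y (β ^ A) β (β ^ Q) ⟩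
      Y * (β * β) * (β ^ Q * β ^ A)   ≤⟨ *-monoˡ (β ^ Q * β ^ A) (ℚ.<⇒≤ (*-pos (^-pos Q 0<β) (^-pos A 0<β))) gap ⟩
      Y′ * (β ^ Q * β ^ A)            ≃⟨ ℚ.≃-sym (ℚ.*-assoc Y′ (β ^ Q) (β ^ A)) ⟩
      Y′ * β ^ Q * β ^ A              ∎)
      where
      open ℚ.≤-Reasoning
      open ℚSolver.+-*-Solver
      A = c ⁻
      B = c ⁺
      P = (c ℤ.+ + 2) ⁺
      Q = (c ℤ.+ + 2) ⁻
      Y  = y ^ suc N
      Y′ = y′ ^ suc N

    gap : ∀ {y y′} → 0ℚᵘ < y → y < y′ → ∃ λ N → y ^ suc N * (β * β) ≤ y′ ^ suc N
    gap {y} {y′} 0<y y<y′ = N , (begin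
      y ^ suc N * (β * β)               ≃⟨ *-≃ʳ (y ^ suc N) (*≡* (cong (ℤ._* + 1) (sym (ℤ.pos-* b b)))) ⟩
      y ^ suc N * (+ (b ℕ.* b) / 1)     ≤⟨ *-monoʳ (y ^ suc N) (^-nonNeg (suc N) (ℚ.<⇒≤ 0<y)) b²≤ ⟩
      y ^ suc N * (1ℚᵘ + δ) ^ suc N     ≃⟨ ℚ.≃-sym (^-distrib-* y (1ℚᵘ + δ) (suc N)) ⟩
      (y * (1ℚᵘ + δ)) ^ suc N           ≤⟨ ^-monoˡ (suc N) (ℚ.<⇒≤ (*-pos 0<y 0<1+δ)) (ℚ.≤-reflexive y[1+δ]) ⟩
      y′ ^ suc N                        ∎)
      where
      open ℚ.≤-Reasoning
      open ℚSolver.+-*-Solver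
      instance
        _ = positive 0<y
        _ = ℚ.pos⇒nonZero y
      0<y′-y : 0ℚᵘ < y′ - y
      0<y′-y = ℚ.<-respˡ-≃ (ℚ.+-inverseʳ y) (ℚ.+-monoˡ-< (- y) y<y′)
      δ = (y′ - y) * 1/ y
      0<δ : 0ℚᵘ < δ
      0<δ = *-pos 0<y′-y (ℚ.positive⁻¹ (1/ y) {{ℚ.1/pos⇒pos y}})
      0<1+δ : 0ℚᵘ < 1ℚᵘ + δ
      0<1+δ = ℚ.<-respˡ-≃ (ℚ.+-identityˡ 0ℚᵘ) (ℚ.+-mono-< 0<1 0<δ)
      N = proj₁ (∃-pow-≥ (b ℕ.* b) 0<δ)
      b²≤ = proj₂ (∃-pow-≥ (b ℕ.* b) 0<δ)
      y[1+δ] : y * (1ℚᵘ + δ) ≃ y′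
      y[1+δ] = begin-equality
        y * (1ℚᵘ + (y′ - y) * 1/ y)       ≃⟨ solve 3 (λ y z i → y :* (con 1ℚᵘ :+ (z :- y) :* i) := y :+ (z :- y) :* (i :* y)) ℚ.≃-refl y y′ (1/ y) ⟩
        y + (y′ - y) * (1/ y * y)         ≃⟨ ℚ.+-congʳ y (*-≃ʳ (y′ - y) (ℚ.*-inverseˡ y)) ⟩
        y + (y′ - y) * 1ℚᵘ                ≃⟨ solve 2 (λ y z → y :+ (z :- y) :* con 1ℚᵘ := z) ℚ.≃-refl y y′ ⟩
        y′                                ∎

    module _ {x y y′ x′} (x<y : x < y) (0<y : 0ℚᵘ < y) (y<y′ : y < y′) (y′<x′ : y′ < x′) where
      locate-in-cell : ∀ N c → y ^ suc N * (β * β) ≤ y′ ^ suc N →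
                       L α (mkℚᵘ c N) → U α (mkℚᵘ (c ℤ.+ + 2) N) →
                       (y ≤ b ^ʳ mkℚᵘ c N) ⊎ (b ^ʳ mkℚᵘ c N ≤ y) → Lᵖ x ⊎ Uᵖ x′
      locate-in-cell N c g Lc Uc (inj₁ le) = inj₁ (y , x<y , mkℚᵘ c N , Lc , le)
      locate-in-cell N c g Lc Uc (inj₂ ge) = inj₂ (y′ , y′<x′ , mkℚᵘ (c ℤ.+ + 2) N , Uc ,
        shift c N 0<y (ℚ.<-trans 0<y y<y′) g ge)

      locate-pos : Lᵖ x ⊎ Uᵖ x′
      locate-pos =
        let (N , g) = gap 0<y y<y′ ; (c , Lc , Uc) = grid α N
        in locate-in-cell N c g Lc Uc (^ʳ-total b (mkℚᵘ c N) 0<y)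

    locatedᵖ : ∀ {x x′} → x < x′ → Lᵖ x ⊎ Uᵖ x′
    locatedᵖ x<x′ with ℚ.<-dense x<x′
    ... | y , x<y , y<x′ with y ℚ.≤? 0ℚᵘ
    ...   | yes y≤0 = let (v , Lv) = L-inhab α in inj₁ (y , x<y , v , Lv , inj₁ y≤0)
    ...   | no  y≰0 = let (y′ , y<y′ , y′<x′) = ℚ.<-dense y<x′ in locate-pos x<y (ℚ.≰⇒> y≰0) y<y′ y′<x′

  pow : ℝ
  pow = record
    { L         = λ y → ∃ λ z → y < z × ∃ λ v → L α v × (z ≤ b ^ʳ v)
    ; U         = λ y → ∃ λ z → z < y × ∃ λ v → U α v × (b ^ʳ v ≤ z)
    ; L-inhab   = let (v , Lv) = L-inhab α in - 1ℚᵘ , 0ℚᵘ , *<* ℤ.-<+ , v , Lv , inj₁ ℚ.≤-refl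
    ; U-inhab   = U-inhabᵖ
    ; L-rounded = λ (z , y<z , h) → let (m , y<m , m<z) = ℚ.<-dense y<z in m , y<m , z , m<z , h
    ; U-rounded = λ (z , z<y , h) → let (m , z<m , m<y) = ℚ.<-dense z<y in m , m<y , z , z<m , h
    ; disjoint  = disjointᵖ
    ; located   = locatedᵖ
    }

pow-positive : ∀ b (1≤b : 1 ℕ.≤ b) α → fromℕ 0 <ᴿ pow b 1≤b α
pow-positive b 1≤b α =
  let (v , Lv) = L-inhab α
      (h , 0<h , h<r) = ℚ.<-dense (0<r v)
      (g , 0<g , g<h) = ℚ.<-dense 0<h
  in g , 0<g , h , g<h , v , Lv , inj₂ (below v (ℚ.<⇒≤ 0<h) (ℚ.<⇒≤ h<r))
  where
  open ℚ.≤-Reasoning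
  β = + b / 1
  0<β : 0ℚᵘ < β
  0<β = ℚ.<-≤-trans 0<1 (ι-mono 1≤b)

  R : ℚᵘ → ℚᵘ
  R v = β ^ (↥ v ⁻)

  R-nz : ∀ v → Positive (R v)
  R-nz v = positive (^-pos (↥ v ⁻) 0<β)

  inv : ∀ v → ℚᵘ
  inv v = (1/ R v) {{ℚ.pos⇒nonZero (R v) {{R-nz v}}}}

  R*inv : ∀ v → inv v * R v ≃ 1ℚᵘ
  R*inv v = ℚ.*-inverseˡ (R v) {{ℚ.pos⇒nonZero (R v) {{R-nz v}}}}

  0<r : ∀ v → 0ℚᵘ < inv v
  0<r v = ℚ.positive⁻¹ (inv v) {{ℚ.1/pos⇒pos (R v) {{R-nz v}}}}

  inv≤1 : ∀ v → inv v ≤ 1ℚᵘ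
  inv≤1 v = begin
    inv v           ≃⟨ ℚ.≃-sym (ℚ.*-identityʳ (inv v)) ⟩
    inv v * 1ℚᵘ     ≤⟨ *-monoʳ (inv v) (ℚ.<⇒≤ (0<r v)) (1≤^ (↥ v ⁻) (ι-mono 1≤b)) ⟩
    inv v * R v     ≃⟨ R*inv v ⟩
    1ℚᵘ             ∎

  below : ∀ v {y} → 0ℚᵘ ≤ y → y ≤ inv v → y ^ ↧ₙ v * R v ≤ β ^ (↥ v ⁺)
  below v {y} 0≤y y≤r = begin
    y ^ ↧ₙ v * R v  ≤⟨ *-monoˡ (R v) (ℚ.<⇒≤ (^-pos (↥ v ⁻) 0<β)) (^suc≤x (ℚᵘ.denominator-1 v) 0≤y (ℚ.≤-trans y≤r (inv≤1 v))) ⟩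
    y * R v         ≤⟨ *-monoˡ (R v) (ℚ.<⇒≤ (^-pos (↥ v ⁻) 0<β)) y≤r ⟩
    inv v * R v     ≃⟨ R*inv v ⟩
    1ℚᵘ             ≤⟨ 1≤^ (↥ v ⁺) (ι-mono 1≤b) ⟩
    β ^ (↥ v ⁺)     ∎

pow-log : ∀ b x (2≤b : 2 ℕ.≤ b) (1≤b : 1 ℕ.≤ b) (1≤x : 1 ℕ.≤ x) → pow b 1≤b (log b x 2≤b 1≤x) ≃ᴿ fromℕ x
pow-log b x 2≤b 1≤b 1≤x = ≥x , ≤x
  where
  ≥x : ¬ (fromℕ x <ᴿ pow b 1≤b (log b x 2≤b 1≤x))
  ≥x (q , x<q , z , q<z , v , (w , v<w , h) , k) =
    ℚ.<-irrefl ℚ.≃-refl (ℚ.<-≤-trans (ℚ.<-trans x<q q<z) (^ʳ-mono v w 1≤b (ℚ.<⇒≤ v<w) k h))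
  ≤x : ¬ (pow b 1≤b (log b x 2≤b 1≤x) <ᴿ fromℕ x)
  ≤x (q , (z , z<q , v , (w , w<v , h) , k) , q<x) =
    ℚ.<-irrefl ℚ.≃-refl (ℚ.<-≤-trans (ℚ.<-trans z<q q<x) (^ʳ-mono w v 1≤b (ℚ.<⇒≤ w<v) h k))

-- x < a/y iff some x′ > x and z > y satisfy x′ z ≤ a, because a ≥ 0 and y > 0.
module _ (a : ℕ) (y : ℝ) (0<y : fromℕ 0 <ᴿ y) where
  private
    a′ = + a / 1

    Lᵈ Uᵈ : ℚᵘ → Set
    Lᵈ q = ∃ λ x → q < x × ∃ λ z → U y z × x * z ≤ a′
    Uᵈ q = ∃ λ x → x < q × ∃ λ z → L y z × 0ℚᵘ < z × a′ ≤ x * z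

    ε = proj₁ 0<y
    0<ε : 0ℚᵘ < ε
    0<ε = proj₁ (proj₂ 0<y)
    Lε : L y ε
    Lε = proj₂ (proj₂ 0<y)

    instance
      _ = positive 0<ε
      _ = ℚ.pos⇒nonZero ε

    a/ : ∀ z → .{{_ : NonZero z}} → a′ * 1/ z * z ≃ a′
    a/ z = ℚ.≃-trans (ℚ.*-assoc a′ (1/ z) z) (ℚ.≃-trans (*-≃ʳ a′ (ℚ.*-inverseˡ z)) (ℚ.*-identityʳ a′))

    disjointᵈ : ∀ {q} → Lᵈ q → Uᵈ q → ⊥
    disjointᵈ (x , q<x , z , Uz , xz≤a) (x′ , x′<q , z′ , Lz′ , 0<z′ , a≤x′z′) =
      ℚ.<-irrefl ℚ.≃-refl (begin-strict
        x′ * z′   <⟨ *-monoˡ-< z′ 0<z′ x′<x ⟩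
        x * z′    ≤⟨ *-monoʳ x (ℚ.≤-trans 0≤x′ (ℚ.<⇒≤ x′<x)) (ℚ.<⇒≤ (L<U y Lz′ Uz)) ⟩
        x * z     ≤⟨ xz≤a ⟩
        a′        ≤⟨ a≤x′z′ ⟩
        x′ * z′   ∎)
      where
      open ℚ.≤-Reasoning
      x′<x = ℚ.<-trans x′<q q<x
      0≤x′ : 0ℚᵘ ≤ x′
      0≤x′ = ℚ.*-cancelʳ-≤-pos z′ {{positive 0<z′}}
        (ℚ.≤-trans (ℚ.≤-reflexive (ℚ.*-zeroˡ z′)) (ℚ.≤-trans (0≤ι a) a≤x′z′))

    locate-pos : ∀ {q x x′ r} → q < x → 0ℚᵘ < x → x < x′ → x′ < r → 0ℚᵘ < a′ → Lᵈ q ⊎ Uᵈ r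
    locate-pos {q} {x} {x′} {r} q<x 0<x x<x′ x′<r 0<a = conclude (located y z′<z)
      where
      open ℚ.≤-Reasoning
      0<x′ = ℚ.<-trans 0<x x<x′
      instance
        x-pos  = positive 0<x
        x′-pos = positive 0<x′
        x-nz   = ℚ.pos⇒nonZero x {{x-pos}}
        x′-nz  = ℚ.pos⇒nonZero x′ {{x′-pos}}
      z  = a′ * (1/ x) {{x-nz}}
      z′ = a′ * (1/ x′) {{x′-nz}}
      0<z′ : 0ℚᵘ < z′
      0<z′ = *-pos 0<a (ℚ.positive⁻¹ ((1/ x′) {{x′-nz}}) {{ℚ.1/pos⇒pos x′ {{x′-pos}}}})
      z′<z : z′ < z
      z′<z = ℚ.*-cancelʳ-<-nonNeg x {{nonNegative (ℚ.<⇒≤ 0<x)}} (begin-strict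
        z′ * x    <⟨ *-monoʳ-< z′ 0<z′ x<x′ ⟩
        z′ * x′   ≃⟨ a/ x′ {{x′-nz}} ⟩
        a′        ≃⟨ ℚ.≃-sym (a/ x {{x-nz}}) ⟩
        z * x     ∎)
      conclude : L y z′ ⊎ U y z → Lᵈ q ⊎ Uᵈ r
      conclude (inj₁ Lz′) = inj₂ (x′ , x′<r , z′ , Lz′ , 0<z′ ,
        ℚ.≤-reflexive (ℚ.≃-sym (ℚ.≃-trans (ℚ.*-comm x′ z′) (a/ x′ {{x′-nz}}))))
      conclude (inj₂ Uz)  = inj₁ (x , q<x , z , Uz ,
        ℚ.≤-reflexive (ℚ.≃-trans (ℚ.*-comm x z) (a/ x {{x-nz}})))

    locatedᵈ : ∀ {q r} → q < r → Lᵈ q ⊎ Uᵈ r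
    locatedᵈ q<r with ℚ.<-dense q<r
    ... | x , q<x , x<r with x ℚ.≤? 0ℚᵘ
    ...   | yes x≤0 =
            let (u , Uu) = U-inhab y
                0≤u = ℚ.<⇒≤ (ℚ.<-trans 0<ε (L<U y Lε Uu))
            in inj₁ (x , q<x , u , Uu ,
                 ℚ.≤-trans (*-monoˡ u 0≤u x≤0) (ℚ.≤-trans (ℚ.≤-reflexive (ℚ.*-zeroˡ u)) (0≤ι a)))
    ...   | no x≰0 with a′ ℚ.≤? 0ℚᵘ
    ...     | yes a≤0 = inj₂ (x , x<r , ε , Lε , 0<ε ,
                ℚ.≤-trans a≤0 (ℚ.<⇒≤ (*-pos (ℚ.≰⇒> x≰0) 0<ε)))
    ...     | no a≰0 = let (x′ , x<x′ , x′<r) = ℚ.<-dense x<r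
                       in locate-pos q<x (ℚ.≰⇒> x≰0) x<x′ x′<r (ℚ.≰⇒> a≰0)

  quotient : ℝ
  quotient = record
    { L         = λ q → ∃ λ x → q < x × ∃ λ z → U y z × x * z ≤ a′
    ; U         = λ q → ∃ λ x → x < q × ∃ λ z → L y z × 0ℚᵘ < z × a′ ≤ x * z
    ; L-inhab   = let (u , Uu) = U-inhab y in
                  - 1ℚᵘ , 0ℚᵘ , *<* ℤ.-<+ , u , Uu , ℚ.≤-trans (ℚ.≤-reflexive (ℚ.*-zeroˡ u)) (0≤ι a)
    ; U-inhab   = a′ * 1/ ε + 1ℚᵘ , a′ * 1/ ε ,
                  ℚ.<-respˡ-≃ (ℚ.+-identityʳ (a′ * 1/ ε)) (ℚ.+-monoʳ-< (a′ * 1/ ε) 0<1) ,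
                  ε , Lε , 0<ε , ℚ.≤-reflexive (ℚ.≃-sym (a/ ε))
    ; L-rounded = λ (z , y<z , h) → let (m , y<m , m<z) = ℚ.<-dense y<z in m , y<m , z , m<z , h
    ; U-rounded = λ (z , z<y , h) → let (m , z<m , m<y) = ℚ.<-dense z<y in m , m<y , z , z<m , h
    ; disjoint  = disjointᵈ
    ; located   = locatedᵈ
    }

open Sum ℕ.+-*-semiring using (sum; *-distribˡ-sum; *-distribʳ-sum; sum-cong-≗)

record Expansion (s n : ℕ) : Set where
  field
    k       : ℕ
    ε       : Fin (suc k) → Fin s
    value   : sum (λ i → toℕ (ε i) ℕ.* s ℕ.^ toℕ i) ≡ n
    leading : toℕ (ε (Fin.fromℕ k)) ≢ 0

expansion : ∀ s n → 2 ℕ.≤ s → 1 ℕ.≤ n → Expansion s n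
expansion s n 2≤s = <-rec (λ n → 1 ℕ.≤ n → Expansion s n) step n
  where
  instance
    _ = ℕ.>-nonZero (ℕ.≤-trans (ℕ.n≤1+n 1) 2≤s)

  one-digit : ∀ n → n ℕ.< s → 1 ℕ.≤ n → Expansion s n
  one-digit n n<s 1≤n = record
    { k       = 0
    ; ε       = λ _ → Fin.fromℕ< n<s
    ; value   = trans (ℕ.+-identityʳ _) (trans (ℕ.*-identityʳ _) (Fin.toℕ-fromℕ< n<s))
    ; leading = λ eq → ℕ.<⇒≢ 1≤n (sym (trans (sym (Fin.toℕ-fromℕ< n<s)) eq))
    }

  prepend : ∀ n → Expansion s (n ℕ./ s) → Expansion s n
  prepend n e = record
    { k       = suc k
    ; ε       = ε′
    ; value   = begin
        toℕ d ℕ.* 1 ℕ.+ sum (λ i → toℕ (ε i) ℕ.* (s ℕ.* s ℕ.^ toℕ i))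
          ≡⟨ cong₂ ℕ._+_ (trans (ℕ.*-identityʳ (toℕ d)) (Fin.toℕ-fromℕ< (ℕ.m%n<n n s)))
               (sum-cong-≗ λ i → trans (cong (toℕ (ε i) ℕ.*_) (ℕ.*-comm s (s ℕ.^ toℕ i)))
                                       (sym (ℕ.*-assoc (toℕ (ε i)) (s ℕ.^ toℕ i) s))) ⟩
        n ℕ.% s ℕ.+ sum (λ i → toℕ (ε i) ℕ.* s ℕ.^ toℕ i ℕ.* s)
          ≡⟨ cong (n ℕ.% s ℕ.+_) (sym (*-distribʳ-sum s (λ i → toℕ (ε i) ℕ.* s ℕ.^ toℕ i))) ⟩
        n ℕ.% s ℕ.+ sum (λ i → toℕ (ε i) ℕ.* s ℕ.^ toℕ i) ℕ.* s
          ≡⟨ cong (λ m → n ℕ.% s ℕ.+ m ℕ.* s) value ⟩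
        n ℕ.% s ℕ.+ n ℕ./ s ℕ.* s
          ≡⟨ sym (ℕ.m≡m%n+[m/n]*n n s) ⟩
        n ∎
    ; leading = leading
    }
    where
    open Relation.Binary.PropositionalEquality.≡-Reasoning
    open Expansion e
    d : Fin s
    d = Fin.fromℕ< (ℕ.m%n<n n s)
    ε′ : Fin (suc (suc k)) → Fin s
    ε′ zero    = d
    ε′ (suc i) = ε i

  step : ∀ n → (∀ {m} → m ℕ.< n → 1 ℕ.≤ m → Expansion s m) → 1 ℕ.≤ n → Expansion s n
  step n rec 1≤n with n ℕ.<? s
  ... | yes n<s = one-digit n n<s 1≤n
  ... | no  n≮s = prepend n (rec (ℕ.m/n<m n s {{ℕ.>-nonZero 1≤n}} 2≤s)
                    (ℕ.n≢0⇒n>0 (λ eq → n≮s (ℕ.m/n≡0⇒m<n eq))))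

enum : ∀ {p} (A : Subset p) → Fin ∣ A ∣ → Fin p
enum (outside ∷ A) i       = suc (enum A i)
enum (inside  ∷ A) zero    = zero
enum (inside  ∷ A) (suc i) = suc (enum A i)

enum-∈ : ∀ {p} (A : Subset p) i → enum A i ∈ A
enum-∈ (outside ∷ A) i       = there (enum-∈ A i)
enum-∈ (inside  ∷ A) zero    = here
enum-∈ (inside  ∷ A) (suc i) = there (enum-∈ A i)

enum-surjective : ∀ {p} (A : Subset p) {d} → d ∈ A → ∃ λ i → enum A i ≡ d
enum-surjective (outside ∷ A) (there d∈A) = let (i , eq) = enum-surjective A d∈A in i , cong suc eq
enum-surjective (inside  ∷ A) here        = zero , refl
enum-surjective (inside  ∷ A) (there d∈A) = let (i , eq) = enum-surjective A d∈A in suc i , cong suc eq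

enum-increasing : ∀ {p} (A : Subset p) {i j} → i Fin.< j → enum A i Fin.< enum A j
enum-increasing (outside ∷ A)                 i<j         = ℕ.s<s (enum-increasing A i<j)
enum-increasing (inside  ∷ A) {zero}  {suc j} _           = ℕ.z<s
enum-increasing (inside  ∷ A) {suc i} {suc j} (ℕ.s<s i<j) = ℕ.s<s (enum-increasing A i<j)

ℕ⁺ : Set
ℕ⁺ = Σ ℕ (1 ℕ.≤_)

module _ {p} (A : Subset p) (2≤s : 2 ℕ.≤ ∣ A ∣) where

  aSeq : ℕ⁺ → ℕ
  aSeq (n , 1≤n) = sum (λ i → toℕ (enum A (ε i)) ℕ.* p ℕ.^ toℕ i)
    where open Expansion (expansion ∣ A ∣ n 2≤s 1≤n)

  logₛp : ℝ
  logₛp = log ∣ A ∣ p 2≤s (ℕ.≤-trans (ℕ.n≤1+n 1) (ℕ.≤-trans 2≤s (∣p∣≤n A)))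

  bSeq : ℕ⁺ → ℝ
  bSeq (n , 1≤n) = quotient (aSeq (n , 1≤n)) (pow n 1≤n logₛp) (pow-positive n 1≤n logₛp)

residues : (q r p : ℕ) → Subset p
residues q r p = tabulate (λ d → does (q ∣? ℕ.∣ toℕ d - r ∣))

module _ (q r p : ℕ) where

  ∈-residues⁺ : ∀ {d : Fin p} → q ∣ ℕ.∣ toℕ d - r ∣ → d ∈ residues q r p
  ∈-residues⁺ {d} q∣ = lookup⇒[]= d _ (trans (lookup∘tabulate _ d) (dec-true (q ∣? _) q∣))

  ∈-residues⁻ : ∀ {d : Fin p} → d ∈ residues q r p → q ∣ ℕ.∣ toℕ d - r ∣
  ∈-residues⁻ {d} d∈ with q ∣? ℕ.∣ toℕ d - r ∣ | trans (sym (lookup∘tabulate (λ d → does (q ∣? ℕ.∣ toℕ d - r ∣)) d)) ([]=⇒lookup d∈)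
  ... | yes q∣ | _ = q∣

  member : ∀ k → (lt : q ℕ.* k ℕ.+ r ℕ.< p) → Fin.fromℕ< lt ∈ residues q r p
  member k lt = ∈-residues⁺ (subst (λ d → q ∣ ℕ.∣ d - r ∣) (sym (Fin.toℕ-fromℕ< lt))
    (divides k (trans (ℕ.m≤n⇒∣n-m∣≡n∸m (ℕ.m≤n+m r (q ℕ.* k)))
      (trans (ℕ.m+n∸n≡m (q ℕ.* k) r) (ℕ.*-comm q k)))))

2≤∣residues∣ : ∀ {q r p} → 2 ℕ.≤ q → q ℕ.+ r ℕ.< p → 2 ℕ.≤ ∣ residues q r p ∣
2≤∣residues∣ {q} {r} {p} 2≤q q+r<p =
  ℕ.≤-trans (ℕ.s≤s (ℕ.≤-trans (ℕ.s≤s ℕ.z≤n) (x∈p⇒∣p-x∣<∣p∣ x∈A-y))) (x∈p⇒∣p-x∣<∣p∣ (member q r p 1 q1+r<p))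
  where
  q1+r<p : q ℕ.* 1 ℕ.+ r ℕ.< p
  q1+r<p = subst (λ m → m ℕ.+ r ℕ.< p) (sym (ℕ.*-identityʳ q)) q+r<p
  q0+r<p : q ℕ.* 0 ℕ.+ r ℕ.< p
  q0+r<p = subst (λ m → m ℕ.+ r ℕ.< p) (sym (ℕ.*-zeroʳ q)) (ℕ.≤-<-trans (ℕ.m≤n+m r q) q+r<p)
  x∈A-y = x∈p∧x≢y⇒x∈p-y (member q r p 0 q0+r<p) λ eq →
    ℕ.<⇒≢ (ℕ.+-monoˡ-< r (ℕ.*-monoʳ-< q {{ℕ.>-nonZero (ℕ.≤-trans (ℕ.n≤1+n 1) 2≤q)}} (ℕ.n<1+n 0)))
      (trans (sym (Fin.toℕ-fromℕ< q0+r<p)) (trans (cong toℕ eq) (Fin.toℕ-fromℕ< q1+r<p)))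

p∸1-nonZero : ∀ {q r p} → 2 ℕ.≤ q → q ℕ.+ r ℕ.< p → ℕ.NonZero (p ℕ.∸ 1)
p∸1-nonZero {q} {r} 2≤q q+r<p =
  ℕ.>-nonZero (ℕ.m<n⇒0<n∸m (ℕ.≤-<-trans (ℕ.≤-trans (ℕ.≤-trans (ℕ.n≤1+n 1) 2≤q) (ℕ.m≤m+n q r)) q+r<p))

module _ {q r p : ℕ} (r<q : r ℕ.< q) where
  private
    instance
      _ = ℕ.>-nonZero (ℕ.≤-trans (ℕ.s≤s ℕ.z≤n) r<q)

    h : Fin ∣ residues q r p ∣ → ℕ
    h i = toℕ (enum (residues q r p) i)

    h-mono-< : ∀ {i j} → i Fin.< j → h i ℕ.< h j
    h-mono-< = enum-increasing (residues q r p)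

    h-mono : ∀ {i j} → i Fin.≤ j → h i ℕ.≤ h j
    h-mono {i} {j} i≤j with Fin.<-cmp i j
    ... | tri< i<j _ _  = ℕ.<⇒≤ (h-mono-< i<j)
    ... | tri≈ _ refl _ = ℕ.≤-refl
    ... | tri> _ _ j<i  = contradiction i≤j (ℕ.<⇒≱ j<i)

    form : ∀ i → ∃ λ k → h i ≡ q ℕ.* k ℕ.+ r
    form i with r ℕ.≤? h i | ∈-residues⁻ q r p (enum-∈ (residues q r p) i)
    ... | yes r≤h | divides k eq = k , trans (sym (ℕ.m∸n+n≡m r≤h))
          (cong (ℕ._+ r) (trans (sym (ℕ.m≤n⇒∣n-m∣≡n∸m r≤h)) (trans eq (ℕ.*-comm k q))))
    ... | no  r≰h | q∣ = contradiction
          (∣⇒≤ {{ℕ.>-nonZero (ℕ.m<n⇒0<n∸m (ℕ.≰⇒> r≰h))}} (subst (q ∣_) (ℕ.m≤n⇒∣m-n∣≡n∸m (ℕ.<⇒≤ (ℕ.≰⇒> r≰h))) q∣))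
          (ℕ.<⇒≱ (ℕ.≤-<-trans (ℕ.m∸n≤m r (h i)) r<q))

    hit : ∀ k → q ℕ.* k ℕ.+ r ℕ.< p → ∃ λ j → h j ≡ q ℕ.* k ℕ.+ r
    hit k lt = let (j , eq) = enum-surjective (residues q r p) (member q r p k lt)
               in j , trans (cong toℕ eq) (Fin.toℕ-fromℕ< lt)

    h<p : ∀ i → h i ℕ.< p
    h<p i = Fin.toℕ<n (enum (residues q r p) i)

    q*+r-mono : ∀ {k l} → k ℕ.≤ l → q ℕ.* k ℕ.+ r ℕ.≤ q ℕ.* l ℕ.+ r
    q*+r-mono k≤l = ℕ.+-monoˡ-≤ r (ℕ.*-monoʳ-≤ q k≤l)

    q*+r-cancel : ∀ {k l} → q ℕ.* k ℕ.+ r ℕ.< q ℕ.* l ℕ.+ r → k ℕ.< l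
    q*+r-cancel {k} {l} lt = ℕ.*-cancelˡ-< q k l (ℕ.+-cancelʳ-< r _ _ lt)

    explicit : ∀ n i → toℕ i ≡ n → h i ≡ q ℕ.* n ℕ.+ r
    explicit zero i i≡0 =
      let (k , hi≡) = form i
          low : q ℕ.* 0 ℕ.+ r ℕ.≤ h i
          low = ℕ.≤-trans (q*+r-mono {0} {k} ℕ.z≤n) (ℕ.≤-reflexive (sym hi≡))
          (j , hj≡) = hit 0 (ℕ.≤-<-trans low (h<p i))
      in ℕ.≤-antisym (ℕ.≤-trans (h-mono {i} {j} (subst (ℕ._≤ toℕ j) (sym i≡0) ℕ.z≤n)) (ℕ.≤-reflexive hj≡)) low
    explicit (suc n) i i≡1+n =
      let n<s : n ℕ.< ∣ residues q r p ∣
          n<s = ℕ.<-trans (subst (n ℕ.<_) (sym i≡1+n) (ℕ.n<1+n n)) (Fin.toℕ<n i)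
          i′ = Fin.fromℕ< n<s
          i′≡n = Fin.toℕ-fromℕ< n<s
          hi′≡ = explicit n i′ i′≡n
          (k , hi≡) = form i
          i′<i = subst₂ ℕ._<_ (sym i′≡n) (sym i≡1+n) (ℕ.n<1+n n)
          low : q ℕ.* suc n ℕ.+ r ℕ.≤ h i
          low = ℕ.≤-trans (q*+r-mono (q*+r-cancel {n} {k} (subst₂ ℕ._<_ hi′≡ hi≡ (h-mono-< i′<i)))) (ℕ.≤-reflexive (sym hi≡))
          (j , hj≡) = hit (suc n) (ℕ.≤-<-trans low (h<p i))
          i′<j : i′ Fin.< j
          i′<j = ℕ.≰⇒> λ j≤i′ → ℕ.<⇒≱ (ℕ.+-monoˡ-< r (ℕ.*-monoʳ-< q (ℕ.n<1+n n)))
                   (subst₂ ℕ._≤_ hj≡ hi′≡ (h-mono j≤i′))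
          i≤j : i Fin.≤ j
          i≤j = subst (ℕ._≤ toℕ j) (trans (cong suc i′≡n) (sym i≡1+n)) i′<j
      in ℕ.≤-antisym (ℕ.≤-trans (h-mono i≤j) (ℕ.≤-reflexive hj≡)) low

  enum-residues : ∀ i → toℕ (enum (residues q r p) i) ≡ q ℕ.* toℕ i ℕ.+ r
  enum-residues i = explicit (toℕ i) i refl

module Submission where

-- The bounds amount to (p-1) a_n + μ ≥ μ (n+1)^α and (p-1) a_n + r ≤ Q n^α, where
-- α = log_s p, μ = q(s-1) + r and Q = q(p-1) + pr, so that m = μ/(p-1) and
-- M = Q/(p-1). Both left-hand sides satisfy linear recursions when a low digit j is
-- prepended to n. The upper bound survives the step because x ↦ x^α is superadditive.
-- The lower one survives because x ↦ x^α is convex: the point belonging to sn + j lies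
-- above the chord from (1, μ) to the point (s(n+1), p((p-1) a_n + μ)) belonging to the
-- digit s-1. Superadditivity turns (n+1)^α into n^α + 1, which gives m n^α ≤ a_n. The
-- bounds are approached along n = s^k - 1 and n = s^k.
--
-- The real α is replaced by rational exponents (d+e)/d ≥ 1 on either side of it, and
-- "X ≤ μ Y^((d+e)/d)" is written X^d ≤ μ^d Y^(d+e), an inequality between naturals.

open import Defs
open import Algebra.Bundles using (CommutativeRing)
open import Data.Empty using (⊥-elim)
open import Data.Fin as Fin using (Fin; zero; suc; toℕ)
import Data.Fin.Properties as Fin
open import Data.Fin.Subset using (∣_∣)
open import Data.Fin.Subset.Properties using (∣p∣≤n)
open import Data.Integer as ℤ using (+_; -[1+_])
import Data.Integer.Properties as ℤ
open import Data.Nat using (ℕ; zero; suc; pred; _+_; _*_; _∸_; _^_; _≤_; _<_; z≤n; s≤s; s≤s⁻¹; NonZero; >-nonZero; >-nonZero⁻¹; ≢-nonZero)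
import Data.Nat.Properties as ℕ
open import Data.Nat.Solver using (module +-*-Solver)
open import Data.Product using (∃; ∃₂; _×_; _,_)
open import Data.Rational.Unnormalised as ℚ using (ℚᵘ; mkℚᵘ; 0ℚᵘ; 1ℚᵘ; _/_; *≤*; *<*; ↥_; ↧ₙ_)
import Data.Rational.Unnormalised.Properties as ℚ
open import Data.Sum using (inj₁; inj₂)
open import Function using (_∘_; it)
open import Relation.Binary.PropositionalEquality using (_≡_; _≢_; refl; sym; trans; cong; cong₂; subst; subst₂)
open import Relation.Nullary using (¬_; yes; no; contradiction)
open import Algebra.Properties.CommutativeSemiring.Exp (CommutativeRing.commutativeSemiring ℚ.+-*-commutativeRing) using () renaming (_^_ to _^ℚ_)
open import Algebra.Properties.Semiring.Sum ℕ.+-*-semiring using (sum; sum-cong-≗; *-distribˡ-sum)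
open +-*-Solver
open ℕ.≤-Reasoning
open ℝ using (L; U; located)

-- Weighted AM-GM, and convexity and superadditivity of the power (d+e)/d.

^-distribʳ-* : ∀ n a b → (a * b) ^ n ≡ a ^ n * b ^ n
^-distribʳ-* zero    a b = refl
^-distribʳ-* (suc n) a b = trans (cong (a * b *_) (^-distribʳ-* n a b))
  (solve 4 (λ a b x y → a :* b :* (x :* y) := a :* x :* (b :* y)) refl a b (a ^ n) (b ^ n))

2ab≤a²+b² : ∀ a b → 2 * (a * b) ≤ a * a + b * b
2ab≤a²+b² a b with ℕ.≤-total a b
... | inj₁ a≤b with ℕ.m≤n⇒∃[o]m+o≡n a≤b
...   | k , refl = ℕ.≤-trans (ℕ.m≤m+n (2 * (a * b)) (k * k)) (ℕ.≤-reflexive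
  (solve 2 (λ a k → con 2 :* (a :* (a :+ k)) :+ k :* k := a :* a :+ (a :+ k) :* (a :+ k)) refl a k))
2ab≤a²+b² a b | inj₂ b≤a with ℕ.m≤n⇒∃[o]m+o≡n b≤a
...   | k , refl = ℕ.≤-trans (ℕ.m≤m+n (2 * (a * b)) (k * k)) (ℕ.≤-reflexive
  (solve 2 (λ b k → con 2 :* ((b :+ k) :* b) :+ k :* k := (b :+ k) :* (b :+ k) :+ b :* b) refl b k))

-- Young's inequality by induction on `n`: `a` times the hypothesis plus `(1 + n) * B` times 2ab ≤
-- a² + b². The terms to be cancelled are added to both sides first, so that no subtraction occurs.
young : ∀ n a b → suc n * (a * b ^ n) ≤ a ^ suc n + n * b ^ suc n
young zero a b = ℕ.≤-reflexive (solve 1 (λ a → con 1 :* (a :* con 1) := a :* con 1 :+ con 0) refl a)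
young (suc n) a b = ℕ.+-cancelˡ-≤ (n * (a * (b * B)) + (1 + n) * (a * a * B)) _ _ (begin
  n * (a * (b * B)) + (1 + n) * (a * a * B) + (2 + n) * (a * (b * B))
    ≡⟨ solve 4 (λ n a b B → n :* (a :* (b :* B)) :+ (con 1 :+ n) :* (a :* a :* B) :+ (con 2 :+ n) :* (a :* (b :* B))
                         := a :* ((con 1 :+ n) :* (a :* B)) :+ (con 1 :+ n) :* B :* (con 2 :* (a :* b))) refl n a b B ⟩
  a * ((1 + n) * (a * B)) + (1 + n) * B * (2 * (a * b))
    ≤⟨ ℕ.+-mono-≤ (ℕ.*-monoʳ-≤ a (young n a b)) (ℕ.*-monoʳ-≤ ((1 + n) * B) (2ab≤a²+b² a b)) ⟩
  a * (A + n * (b * B)) + (1 + n) * B * (a * a + b * b)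
    ≡⟨ solve 5 (λ n a b A B → a :* (A :+ n :* (b :* B)) :+ (con 1 :+ n) :* B :* (a :* a :+ b :* b)
                           := n :* (a :* (b :* B)) :+ (con 1 :+ n) :* (a :* a :* B) :+ (a :* A :+ (con 1 :+ n) :* (b :* (b :* B)))) refl n a b A B ⟩
  n * (a * (b * B)) + (1 + n) * (a * a * B) + (a * A + (1 + n) * (b * (b * B))) ∎)
  where
  A = a ^ suc n
  B = b ^ n

n^n-nonZero : ∀ n → NonZero (n ^ n)
n^n-nonZero zero      = _
n^n-nonZero n@(suc _) = ℕ.m^n≢0 n n

-- The induction step of AM-GM: for `S` a sum of `n` numbers, adjoining `P` gives (S/n)^n P ≤
-- ((S+P)/(n+1))^(n+1). It is `young` at a = n(S+P), b = (n+1)S, after removing the common term n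
-- b^(n+1).
mean-step : ∀ n S P → suc n ^ suc n * (S ^ n * P) ≤ n ^ n * (S + P) ^ suc n
mean-step zero S P = begin
  1 * (1 * P)            ≡⟨ solve 1 (λ x → con 1 :* (con 1 :* x) := x) refl P ⟩
  P                      ≤⟨ ℕ.m≤n+m P S ⟩
  S + P                  ≡⟨ solve 1 (λ x → x := con 1 :* (x :* con 1)) refl (S + P) ⟩
  1 * ((S + P) * 1)      ∎
mean-step n@(suc _) S P = ℕ.*-cancelˡ-≤ n (ℕ.+-cancelˡ-≤ (n * (b * b ^ n)) _ _ (begin
  n * (b * b ^ n) + n * (suc n ^ suc n * (S ^ n * P))
    ≡⟨ solve 6 (λ n b bn N Sn P → n :* (b :* bn) :+ n :* ((con 1 :+ n) :* N :* (Sn :* P))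
                               := n :* (b :* bn) :+ n :* ((con 1 :+ n) :* (N :* Sn) :* P)) refl n b (b ^ n) (suc n ^ n) (S ^ n) P ⟩
  n * (b * b ^ n) + n * (suc n * (suc n ^ n * S ^ n) * P)
    ≡⟨ cong (λ z → n * (b * b ^ n) + n * (suc n * z * P)) (sym (^-distribʳ-* n (suc n) S)) ⟩
  n * (b * b ^ n) + n * (suc n * b ^ n * P)
    ≡⟨ solve 4 (λ n S P bn → n :* ((con 1 :+ n) :* S :* bn) :+ n :* ((con 1 :+ n) :* bn :* P)
                          := (con 1 :+ n) :* (n :* (S :+ P) :* bn)) refl n S P (b ^ n) ⟩
  suc n * (a * b ^ n)
    ≤⟨ young n a b ⟩
  a ^ suc n + n * b ^ suc n
    ≡⟨ ℕ.+-comm (a ^ suc n) _ ⟩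
  n * b ^ suc n + a ^ suc n
    ≡⟨ cong (λ z → n * b ^ suc n + z) (trans (^-distribʳ-* (suc n) n (S + P)) (ℕ.*-assoc n (n ^ n) _)) ⟩
  n * (b * b ^ n) + n * (n ^ n * (S + P) ^ suc n) ∎))
  where
  a = n * (S + P)
  b = suc n * S

-- Starts from `e` copies of `g`, where equality holds, and adjoins the copies of `P` one at a time
-- by `mean-step`.
weighted-AM-GM : ∀ d e P g → (d + e) ^ (d + e) * (P ^ d * g ^ e) ≤ (d * P + e * g) ^ (d + e)
weighted-AM-GM zero    e P g = ℕ.≤-reflexive (trans (cong (e ^ e *_) (ℕ.*-identityˡ (g ^ e))) (sym (^-distribʳ-* e e g)))
weighted-AM-GM (suc d) e P g = ℕ.*-cancelˡ-≤ (n ^ n) {{n^n-nonZero n}} (begin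
  n ^ n * (suc n ^ suc n * (P * P ^ d * g ^ e))
    ≡⟨ solve 5 (λ N M P Pd ge → N :* (M :* (P :* Pd :* ge)) := M :* (N :* (Pd :* ge) :* P)) refl
         (n ^ n) (suc n ^ suc n) P (P ^ d) (g ^ e) ⟩
  suc n ^ suc n * (n ^ n * (P ^ d * g ^ e) * P)
    ≤⟨ ℕ.*-monoʳ-≤ (suc n ^ suc n) (ℕ.*-monoˡ-≤ P (weighted-AM-GM d e P g)) ⟩
  suc n ^ suc n * (S ^ n * P)
    ≤⟨ mean-step n S P ⟩
  n ^ n * (S + P) ^ suc n
    ≡⟨ cong (λ z → n ^ n * z ^ suc n) (solve 3 (λ dP eg P → dP :+ eg :+ P := P :+ dP :+ eg) refl (d * P) (e * g) P) ⟩
  n ^ n * (P + d * P + e * g) ^ suc n ∎)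
  where
  n = d + e
  S = d * P + e * g

mean≤⇒product≤ : ∀ d e {P g t} → d * P + e * g ≤ (d + e) * t → P ^ d * g ^ e ≤ t ^ (d + e)
mean≤⇒product≤ d e {P} {g} {t} mean≤ = ℕ.*-cancelˡ-≤ (n ^ n) {{n^n-nonZero n}} (begin
  n ^ n * (P ^ d * g ^ e)    ≤⟨ weighted-AM-GM d e P g ⟩
  (d * P + e * g) ^ n        ≤⟨ ℕ.^-monoˡ-≤ n mean≤ ⟩
  (n * t) ^ n                ≡⟨ ^-distribʳ-* n n t ⟩
  n ^ n * t ^ n              ∎)
  where n = d + e

-- With T = A/B and t = x/y, this says that t^((d+e)/d) lies above its tangent at t = 1:
-- if d T + e ≤ (d+e) t then T^d ≤ t^(d+e).
tangent : ∀ d e {A B x y} .{{_ : NonZero B}} → d * (A * y) + e * (B * y) ≤ (d + e) * (x * B) →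
          A ^ d * y ^ (d + e) ≤ x ^ (d + e) * B ^ d
tangent d e {A} {B} {x} {y} le = ℕ.*-cancelˡ-≤ (B ^ e) {{ℕ.m^n≢0 B e}} (begin
  B ^ e * (A ^ d * y ^ (d + e))        ≡⟨ cong (λ z → B ^ e * (A ^ d * z)) (ℕ.^-distribˡ-+-* y d e) ⟩
  B ^ e * (A ^ d * (y ^ d * y ^ e))    ≡⟨ solve 4 (λ a b c d → a :* (b :* (c :* d)) := b :* c :* (a :* d)) refl (B ^ e) (A ^ d) (y ^ d) (y ^ e) ⟩
  A ^ d * y ^ d * (B ^ e * y ^ e)      ≡⟨ cong₂ _*_ (sym (^-distribʳ-* d A y)) (sym (^-distribʳ-* e B y)) ⟩
  (A * y) ^ d * (B * y) ^ e            ≤⟨ mean≤⇒product≤ d e le ⟩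
  (x * B) ^ (d + e)                    ≡⟨ ^-distribʳ-* (d + e) x B ⟩
  x ^ (d + e) * B ^ (d + e)            ≡⟨ cong (x ^ (d + e) *_) (ℕ.^-distribˡ-+-* B d e) ⟩
  x ^ (d + e) * (B ^ d * B ^ e)        ≡⟨ solve 3 (λ a b c → a :* (b :* c) := c :* (a :* b)) refl (x ^ (d + e)) (B ^ d) (B ^ e) ⟩
  B ^ e * (x ^ (d + e) * B ^ d)        ∎)

-- If (1+u, Y′) were below the graph, both ends of the chord would lie strictly above the
-- tangent at (1+u, Y′) of the rescaled graph through that point, and hence so would
-- their mean with weights u and i.
chord : ∀ d e {μ Y Y′} u i .{{_ : NonZero μ}} .{{_ : NonZero Y′}} → 0 < u + i →
        μ ^ d * suc (u + i) ^ (d + e) ≤ Y ^ d →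
        u * Y + i * μ ≤ (u + i) * Y′ →
        μ ^ d * suc u ^ (d + e) ≤ Y′ ^ d
chord d e {μ} {Y} {Y′} u i 0<u+i end below = ℕ.≮⇒≥ λ lt →
  let right : Y′ ^ d * X ^ c < Y ^ d * X′ ^ c
      right = ℕ.*-cancelˡ-< (μ ^ d) _ _ (begin-strict
        μ ^ d * (Y′ ^ d * X ^ c)   ≡⟨ solve 3 (λ a b c → a :* (b :* c) := a :* c :* b) refl (μ ^ d) (Y′ ^ d) (X ^ c) ⟩
        μ ^ d * X ^ c * Y′ ^ d     ≤⟨ ℕ.*-monoˡ-≤ (Y′ ^ d) end ⟩
        Y ^ d * Y′ ^ d             <⟨ ℕ.*-monoʳ-< (Y ^ d) {{Y^d≢0}} lt ⟩
        Y ^ d * (μ ^ d * X′ ^ c)   ≡⟨ solve 3 (λ a b c → a :* (b :* c) := b :* (a :* c)) refl (Y ^ d) (μ ^ d) (X′ ^ c) ⟩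
        μ ^ d * (Y ^ d * X′ ^ c)   ∎)
      -- Contrapositive of `tangent` with T = Y/Y′ and t = X/X′: the right end is strictly above the
      -- tangent. `t₂` is the same for the left end, with T = μ/Y′ and t = 1/X′.
      t₁ : c * (X * Y′) < d * (Y * X′) + e * (Y′ * X′)
      t₁ = ℕ.≰⇒> λ le → ℕ.<⇒≱ right (ℕ.≤-trans (tangent d e le) (ℕ.≤-reflexive (ℕ.*-comm (X ^ c) (Y′ ^ d))))
      t₂ : c * (1 * Y′) < d * (μ * X′) + e * (Y′ * X′)
      t₂ = ℕ.≰⇒> λ le → ℕ.<⇒≱ lt (ℕ.≤-trans (tangent d e le) (ℕ.≤-reflexive
             (trans (cong (_* Y′ ^ d) (ℕ.^-zeroˡ c)) (ℕ.*-identityˡ (Y′ ^ d)))))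
      Σ = c * (Y′ * ((u + i) * X′))
  in ℕ.<-irrefl refl (begin-strict
    Σ                                                         ≡⟨ sym (ℕ.+-identityʳ Σ) ⟩
    -- `t₁` and `t₂` are used in the form `suc _ ≤ _`, so their weighted sum gains `u + i`, which is
    -- positive even when one of the two weights is 0.
    Σ + 0                                                     <⟨ ℕ.+-monoʳ-< Σ 0<u+i ⟩
    Σ + (u + i)                                               ≡⟨ solve 4 (λ c y u i → c :* (y :* ((u :+ i) :* (con 1 :+ u))) :+ (u :+ i)
                                                                   := u :* (con 1 :+ c :* ((con 1 :+ (u :+ i)) :* y)) :+ i :* (con 1 :+ c :* (con 1 :* y))) refl c Y′ u i ⟩
    u * suc (c * (X * Y′)) + i * suc (c * (1 * Y′))           ≤⟨ ℕ.+-mono-≤ (ℕ.*-monoʳ-≤ u t₁) (ℕ.*-monoʳ-≤ i t₂) ⟩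
    u * (d * (Y * X′) + e * (Y′ * X′)) + i * (d * (μ * X′) + e * (Y′ * X′))
      ≡⟨ solve 8 (λ u i d e y x y′ m → u :* (d :* (y :* x) :+ e :* (y′ :* x)) :+ i :* (d :* (m :* x) :+ e :* (y′ :* x))
                                    := d :* x :* (u :* y :+ i :* m) :+ e :* (y′ :* ((u :+ i) :* x))) refl u i d e Y X′ Y′ μ ⟩
    d * X′ * (u * Y + i * μ) + e * (Y′ * ((u + i) * X′))      ≤⟨ ℕ.+-monoˡ-≤ _ (ℕ.*-monoʳ-≤ (d * X′) below) ⟩
    d * X′ * ((u + i) * Y′) + e * (Y′ * ((u + i) * X′))       ≡⟨ solve 5 (λ d e x y w → d :* x :* (w :* y) :+ e :* (y :* (w :* x)) := (d :+ e) :* (y :* (w :* x))) refl d e X′ Y′ (u + i) ⟩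
    Σ                                                         ∎)
  where
  c = d + e
  X = suc (u + i)
  X′ = suc u
  Y^d≢0 : NonZero (Y ^ d)
  Y^d≢0 = >-nonZero (ℕ.≤-trans (ℕ.*-mono-≤ (ℕ.m^n>0 μ d) (ℕ.m^n>0 X c)) end)

-- With c = (d+e)/d, the claim is that X ≤ Q Y^c implies X + Qj ≤ Q (Y+j)^c. If X ≤ QY, then X + Qj
-- ≤ Q(Y+j), and Y+j ≥ 1 is at most its c-th power. If QY ≤ X, then (X+Qj)/X ≤ (Y+j)/Y ≤
-- ((Y+j)/Y)^c.
^-superadditive : ∀ d e {Q X Y} j .{{_ : NonZero Y}} → X ^ d ≤ Q ^ d * Y ^ (d + e) →
                  (X + Q * j) ^ d ≤ Q ^ d * (Y + j) ^ (d + e)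
^-superadditive d e {Q} {X} {Y} j le with ℕ.≤-total X (Q * Y)
... | inj₁ X≤QY = begin
  (X + Q * j) ^ d            ≤⟨ ℕ.^-monoˡ-≤ d (ℕ.≤-trans (ℕ.+-monoˡ-≤ (Q * j) X≤QY) (ℕ.≤-reflexive (sym (ℕ.*-distribˡ-+ Q Y j)))) ⟩
  (Q * (Y + j)) ^ d          ≡⟨ ^-distribʳ-* d Q (Y + j) ⟩
  Q ^ d * (Y + j) ^ d        ≤⟨ ℕ.*-monoʳ-≤ (Q ^ d) (ℕ.^-monoʳ-≤ (Y + j) {{>-nonZero (ℕ.≤-trans (>-nonZero⁻¹ Y) (ℕ.m≤m+n Y j))}} (ℕ.m≤m+n d e)) ⟩
  Q ^ d * (Y + j) ^ (d + e)  ∎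
... | inj₂ QY≤X = ℕ.*-cancelˡ-≤ (Y ^ d) {{ℕ.m^n≢0 Y d}} (begin
  Y ^ d * (X + Q * j) ^ d                ≡⟨ sym (^-distribʳ-* d Y (X + Q * j)) ⟩
  (Y * (X + Q * j)) ^ d                  ≤⟨ ℕ.^-monoˡ-≤ d secant ⟩
  (X * (Y + j)) ^ d                      ≡⟨ ^-distribʳ-* d X (Y + j) ⟩
  X ^ d * (Y + j) ^ d                    ≤⟨ ℕ.*-monoˡ-≤ ((Y + j) ^ d) le ⟩
  Q ^ d * Y ^ (d + e) * (Y + j) ^ d      ≡⟨ cong (λ z → Q ^ d * z * (Y + j) ^ d) (ℕ.^-distribˡ-+-* Y d e) ⟩
  Q ^ d * (Y ^ d * Y ^ e) * (Y + j) ^ d  ≡⟨ solve 4 (λ q a b c → q :* (a :* b) :* c := a :* (q :* (c :* b))) refl (Q ^ d) (Y ^ d) (Y ^ e) ((Y + j) ^ d) ⟩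
  Y ^ d * (Q ^ d * ((Y + j) ^ d * Y ^ e))        ≤⟨ ℕ.*-monoʳ-≤ (Y ^ d) (ℕ.*-monoʳ-≤ (Q ^ d) (ℕ.*-monoʳ-≤ ((Y + j) ^ d) (ℕ.^-monoˡ-≤ e (ℕ.m≤m+n Y j)))) ⟩
  Y ^ d * (Q ^ d * ((Y + j) ^ d * (Y + j) ^ e))  ≡⟨ cong (λ z → Y ^ d * (Q ^ d * z)) (sym (ℕ.^-distribˡ-+-* (Y + j) d e)) ⟩
  Y ^ d * (Q ^ d * (Y + j) ^ (d + e))    ∎)
  where
  secant : Y * (X + Q * j) ≤ X * (Y + j)
  secant = begin
    Y * (X + Q * j)      ≡⟨ solve 4 (λ x y q j → y :* (x :+ q :* j) := x :* y :+ q :* y :* j) refl X Y Q j ⟩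
    X * Y + Q * Y * j    ≤⟨ ℕ.+-monoʳ-≤ (X * Y) (ℕ.*-monoˡ-≤ j QY≤X) ⟩
    X * Y + X * j        ≡⟨ sym (ℕ.*-distribˡ-+ X Y j) ⟩
    X * (Y + j)          ∎

-- Digit strings, and the bounds on a_n by induction on the digits.

eval : ∀ b {k} → (Fin k → ℕ) → ℕ
eval b f = sum (λ i → f i * b ^ toℕ i)

eval-suc : ∀ b {k} (f : Fin (suc k) → ℕ) → eval b f ≡ f zero + b * eval b (f ∘ suc)
eval-suc b f = cong₂ _+_ (ℕ.*-identityʳ (f zero)) (trans
  (sum-cong-≗ λ i → solve 3 (λ x b y → x :* (b :* y) := b :* (x :* y)) refl (f (suc i)) b (b ^ toℕ i))
  (sym (*-distribˡ-sum b (λ i → f (suc i) * b ^ toℕ i))))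

-- Prepending the digit `j`, where `i` is its distance from the top digit s-1. `chord` applies with
-- u = j + sn: the right end has abscissa 1+u+i = s(n+1) and height `Y`, the value that the digit
-- s-1 would produce, and it obeys the bound by the induction hypothesis and s^c ≤ p^d.
extend-lower : ∀ d e {P q r s} j i {n a} → let p = suc P; c = d + e; μ = q * (s ∸ 1) + r in
  .{{NonZero μ}} → suc j + i ≡ s →
  2 ≤ s → s ≤ p → q * n ≤ a → s ^ c ≤ p ^ d → μ ^ d * suc n ^ c ≤ (P * a + μ) ^ d →
  μ ^ d * suc (j + s * n) ^ c ≤ (P * (q * j + r + p * a) + μ) ^ d
extend-lower d e {P} {q} {r} {s} j i {n} {a} refl 2≤s s≤p qn≤a s^c≤p^d ih =
  chord d e u i {{it}} {{>-nonZero (ℕ.≤-trans (>-nonZero⁻¹ μ) (ℕ.m≤n+m μ (P * (q * j + r + p * a))))}} 0<u+i scaled below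
  where
  p = suc P
  c = d + e
  μ = q * (j + i) + r
  u = j + s * n
  Y = p * (P * a + μ)
  Y′ = P * (q * j + r + p * a) + μ

  u+i≡ : u + i ≡ j + i + s * n
  u+i≡ = solve 3 (λ j i m → j :+ m :+ i := j :+ i :+ m) refl j i (s * n)

  0<u+i : 0 < u + i
  0<u+i = ℕ.≤-trans (s≤s⁻¹ 2≤s) (ℕ.≤-trans (ℕ.m≤m+n (j + i) (s * n)) (ℕ.≤-reflexive (sym u+i≡)))

  scaled : μ ^ d * suc (u + i) ^ c ≤ Y ^ d
  scaled = begin
    μ ^ d * suc (u + i) ^ c       ≡⟨ cong (λ z → μ ^ d * z ^ c) (trans (cong suc u+i≡) (sym (ℕ.*-suc s n))) ⟩
    μ ^ d * (s * suc n) ^ c       ≡⟨ cong (μ ^ d *_) (^-distribʳ-* c s (suc n)) ⟩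
    μ ^ d * (s ^ c * suc n ^ c)   ≡⟨ solve 3 (λ a b c → a :* (b :* c) := b :* (a :* c)) refl (μ ^ d) (s ^ c) (suc n ^ c) ⟩
    s ^ c * (μ ^ d * suc n ^ c)   ≤⟨ ℕ.*-mono-≤ s^c≤p^d ih ⟩
    p ^ d * (P * a + μ) ^ d       ≡⟨ sym (^-distribʳ-* d p (P * a + μ)) ⟩
    Y ^ d                         ∎

  -- The chord has slope at least Pq. Lowering the last digit by `i` lowers the height by exactly Pq
  -- i, that is, Y′ = Y - Pq i, so the point (1+u, Y′) is not below the chord.
  linear : μ + (u + i) * (P * q) ≤ Y
  linear = begin
    μ + (u + i) * (P * q)                     ≡⟨ cong (λ z → μ + z * (P * q)) u+i≡ ⟩
    μ + (j + i + s * n) * (P * q)             ≡⟨ solve 6 (λ m w s n P q → m :+ (w :+ s :* n) :* (P :* q) := m :+ P :* (q :* w) :+ P :* (s :* (q :* n))) refl μ (j + i) s n P q ⟩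
    μ + P * (q * (j + i)) + P * (s * (q * n)) ≤⟨ ℕ.+-mono-≤ (ℕ.+-monoʳ-≤ μ (ℕ.*-monoʳ-≤ P (ℕ.m≤m+n _ r))) (ℕ.*-monoʳ-≤ P (ℕ.*-mono-≤ s≤p qn≤a)) ⟩
    μ + P * μ + P * (p * a)                   ≡⟨ solve 3 (λ m P a → m :+ P :* m :+ P :* ((con 1 :+ P) :* a) := (con 1 :+ P) :* (P :* a :+ m)) refl μ P a ⟩
    Y                                         ∎

  below : u * Y + i * μ ≤ (u + i) * Y′
  below = ℕ.+-cancelʳ-≤ (i * ((u + i) * (P * q))) _ _ (begin
    u * Y + i * μ + i * ((u + i) * (P * q))     ≡⟨ solve 4 (λ x i m y → x :+ i :* m :+ i :* y := x :+ i :* (m :+ y)) refl (u * Y) i μ ((u + i) * (P * q)) ⟩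
    u * Y + i * (μ + (u + i) * (P * q))         ≤⟨ ℕ.+-monoʳ-≤ (u * Y) (ℕ.*-monoʳ-≤ i linear) ⟩
    u * Y + i * Y                               ≡⟨ sym (ℕ.*-distribʳ-+ Y u i) ⟩
    (u + i) * Y                                 ≡⟨ solve 7 (λ w P q j i r a → w :* ((con 1 :+ P) :* (P :* a :+ (q :* (j :+ i) :+ r)))
                                                   := w :* (P :* (q :* j :+ r :+ (con 1 :+ P) :* a) :+ (q :* (j :+ i) :+ r)) :+ i :* (w :* (P :* q))) refl (u + i) P q j i r a ⟩
    (u + i) * Y′ + i * ((u + i) * (P * q))      ∎)

module Digits {s P q r : ℕ} (2≤s : 2 ≤ s) (2≤q : 2 ≤ q) (s≤p : s ≤ suc P)
              (h : Fin s → ℕ) (h≡ : ∀ i → h i ≡ q * toℕ i + r) where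

  p μ Q : ℕ
  p = suc P
  μ = q * (s ∸ 1) + r
  Q = q * P + p * r

  instance
    s≢0 : NonZero s
    s≢0 = >-nonZero (ℕ.≤-trans (s≤s z≤n) 2≤s)

    μ≢0 : NonZero μ
    μ≢0 = >-nonZero (ℕ.≤-trans (ℕ.*-mono-≤ (ℕ.≤-trans (s≤s z≤n) 2≤q) (ℕ.m<n⇒0<n∸m 2≤s)) (ℕ.m≤m+n _ r))

  -- These unfold to the sums in `Expansion.value` and in `aSeq`, so results about them apply there
  -- directly.
  number image : ∀ {k} → (Fin k → Fin s) → ℕ
  number ε = eval s (toℕ ∘ ε)
  image ε = eval p (h ∘ ε)

  number-suc : ∀ {k} (ε : Fin (suc k) → Fin s) → number ε ≡ toℕ (ε zero) + s * number (ε ∘ suc)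
  number-suc ε = eval-suc s (toℕ ∘ ε)

  image-suc : ∀ {k} (ε : Fin (suc k) → Fin s) → image ε ≡ h (ε zero) + p * image (ε ∘ suc)
  image-suc ε = eval-suc p (h ∘ ε)

  number<s^k : ∀ {k} (ε : Fin k → Fin s) → number ε < s ^ k
  number<s^k {zero}  ε = s≤s z≤n
  number<s^k {suc k} ε = begin-strict
    number ε                                ≡⟨ number-suc ε ⟩
    toℕ (ε zero) + s * number (ε ∘ suc)     <⟨ ℕ.+-monoˡ-< _ (Fin.toℕ<n (ε zero)) ⟩
    s + s * number (ε ∘ suc)                ≡⟨ sym (ℕ.*-suc s _) ⟩
    s * suc (number (ε ∘ suc))              ≤⟨ ℕ.*-monoʳ-≤ s (number<s^k (ε ∘ suc)) ⟩
    s * s ^ k                              ∎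

  -- A crude bound, wanted only for the slope of the chord in `extend-lower`.
  q*number≤image : ∀ {k} (ε : Fin k → Fin s) → q * number ε ≤ image ε
  q*number≤image {zero}  ε = ℕ.≤-reflexive (ℕ.*-zeroʳ q)
  q*number≤image {suc k} ε = begin
    q * number ε                                     ≡⟨ cong (q *_) (number-suc ε) ⟩
    q * (toℕ (ε zero) + s * number (ε ∘ suc))        ≡⟨ solve 4 (λ q j s n → q :* (j :+ s :* n) := q :* j :+ s :* (q :* n)) refl q (toℕ (ε zero)) s _ ⟩
    q * toℕ (ε zero) + s * (q * number (ε ∘ suc))    ≤⟨ ℕ.+-mono-≤ (ℕ.≤-trans (ℕ.m≤m+n _ r) (ℕ.≤-reflexive (sym (h≡ (ε zero))))) (ℕ.*-mono-≤ s≤p (q*number≤image (ε ∘ suc))) ⟩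
    h (ε zero) + p * image (ε ∘ suc)                ≡⟨ sym (image-suc ε) ⟩
    image ε                                         ∎

  h≤μ : ∀ i → h i ≤ μ
  h≤μ i = ℕ.≤-trans (ℕ.≤-reflexive (h≡ i)) (ℕ.+-monoˡ-≤ r (ℕ.*-monoʳ-≤ q (ℕ.∸-monoˡ-≤ 1 (Fin.toℕ<n i))))

  -- `μ` is the top digit h(s-1), and prepending it multiplies P a + μ by `p`. Equality therefore
  -- holds when all digits are s-1, at n = s^k - 1, where the infimum is approached.
  image-≤ : ∀ {k} (ε : Fin k → Fin s) → P * image ε + μ ≤ μ * p ^ k
  image-≤ {zero}  ε = ℕ.≤-reflexive (trans (cong (_+ μ) (ℕ.*-zeroʳ P)) (sym (ℕ.*-identityʳ μ)))
  image-≤ {suc k} ε = begin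
    P * image ε + μ                                       ≡⟨ cong (λ z → P * z + μ) (image-suc ε) ⟩
    P * (h (ε zero) + p * image (ε ∘ suc)) + μ            ≤⟨ ℕ.+-monoˡ-≤ μ (ℕ.*-monoʳ-≤ P (ℕ.+-monoˡ-≤ _ (h≤μ (ε zero)))) ⟩
    P * (μ + p * image (ε ∘ suc)) + μ                     ≡⟨ solve 3 (λ P m a → P :* (m :+ (con 1 :+ P) :* a) :+ m := (con 1 :+ P) :* (P :* a :+ m)) refl P μ _ ⟩
    p * (P * image (ε ∘ suc) + μ)                         ≤⟨ ℕ.*-monoʳ-≤ p (image-≤ (ε ∘ suc)) ⟩
    p * (μ * p ^ k)                                       ≡⟨ solve 3 (λ p m x → p :* (m :* x) := m :* (p :* x)) refl p μ (p ^ k) ⟩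
    μ * p ^ suc k                                         ∎

  image-lower : ∀ d e → s ^ (d + e) ≤ p ^ d → ∀ {k} (ε : Fin k → Fin s) →
                μ ^ d * suc (number ε) ^ (d + e) ≤ (P * image ε + μ) ^ d
  -- The induction starts at the empty string, n = a = 0, where equality holds: this is the left end
  -- (1, μ) of every chord.
  image-lower d e s^c≤p^d {zero} ε = ℕ.≤-reflexive (trans
    (trans (cong (μ ^ d *_) (ℕ.^-zeroˡ (d + e))) (ℕ.*-identityʳ (μ ^ d)))
    (cong (λ z → (z + μ) ^ d) (sym (ℕ.*-zeroʳ P))))
  image-lower d e s^c≤p^d {suc k} ε
    with ℕ.m≤n⇒∃[o]m+o≡n (Fin.toℕ<n (ε zero))
  ... | i , eq = subst₂ (λ n a → μ ^ d * suc n ^ (d + e) ≤ (P * a + μ) ^ d)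
    (sym (number-suc ε)) (trans (cong (_+ p * image (ε ∘ suc)) (sym (h≡ (ε zero)))) (sym (image-suc ε)))
    (extend-lower d e {P} {q} {r} (toℕ (ε zero)) i eq 2≤s s≤p (q*number≤image (ε ∘ suc)) s^c≤p^d
      (image-lower d e s^c≤p^d (ε ∘ suc)))

  LeadingNonZero : ∀ {k} → (Fin (suc k) → Fin s) → Set
  LeadingNonZero {k} ε = toℕ (ε (Fin.fromℕ k)) ≢ 0

  s^k≤number : ∀ {k} (ε : Fin (suc k) → Fin s) → LeadingNonZero ε → s ^ k ≤ number ε
  s^k≤number {zero}  ε lead = ℕ.≤-trans (ℕ.n≢0⇒n>0 lead) (ℕ.≤-trans (ℕ.m≤m+n _ _) (ℕ.≤-reflexive (sym (number-suc ε))))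
  s^k≤number {suc k} ε lead = begin
    s * s ^ k                             ≤⟨ ℕ.*-monoʳ-≤ s (s^k≤number (ε ∘ suc) lead) ⟩
    s * number (ε ∘ suc)                   ≤⟨ ℕ.m≤n+m _ _ ⟩
    toℕ (ε zero) + s * number (ε ∘ suc)    ≡⟨ sym (number-suc ε) ⟩
    number ε                               ∎

  -- Equality holds for leading digit 1 followed by zeros: P(q+r) + r = Q, and prepending the digit
  -- 0 multiplies P a + r by `p`. This is the case n = s^k, where the supremum is approached.
  image-≥ : ∀ {k} (ε : Fin (suc k) → Fin s) → LeadingNonZero ε → Q * p ^ k ≤ P * image ε + r
  image-≥ {zero} ε lead = begin
    Q * 1                                        ≡⟨ solve 3 (λ q P r → (q :* P :+ (con 1 :+ P) :* r) :* con 1 := P :* (q :* con 1 :+ r) :+ r) refl q P r ⟩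
    P * (q * 1 + r) + r                          ≤⟨ ℕ.+-monoˡ-≤ r (ℕ.*-monoʳ-≤ P (ℕ.+-monoˡ-≤ r (ℕ.*-monoʳ-≤ q (ℕ.n≢0⇒n>0 lead)))) ⟩
    P * (q * toℕ (ε zero) + r) + r               ≡⟨ cong (λ z → P * z + r) (trans (sym (h≡ (ε zero))) (solve 2 (λ x p → x := x :+ p :* con 0) refl (h (ε zero)) p)) ⟩
    P * (h (ε zero) + p * image (ε ∘ suc)) + r   ≡⟨ cong (λ z → P * z + r) (sym (image-suc ε)) ⟩
    P * image ε + r                              ∎
  image-≥ {suc k} ε lead = begin
    Q * (p * p ^ k)                              ≡⟨ solve 3 (λ Q p x → Q :* (p :* x) := p :* (Q :* x)) refl Q p (p ^ k) ⟩
    p * (Q * p ^ k)                              ≤⟨ ℕ.*-monoʳ-≤ p (image-≥ (ε ∘ suc) lead) ⟩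
    p * (P * image (ε ∘ suc) + r)                ≡⟨ solve 3 (λ P a r → (con 1 :+ P) :* (P :* a :+ r) := P :* (r :+ (con 1 :+ P) :* a) :+ r) refl P (image (ε ∘ suc)) r ⟩
    P * (r + p * image (ε ∘ suc)) + r            ≤⟨ ℕ.+-monoˡ-≤ r (ℕ.*-monoʳ-≤ P (ℕ.+-monoˡ-≤ _ (ℕ.≤-trans (ℕ.m≤n+m r _) (ℕ.≤-reflexive (sym (h≡ (ε zero))))))) ⟩
    P * (h (ε zero) + p * image (ε ∘ suc)) + r   ≡⟨ cong (λ z → P * z + r) (sym (image-suc ε)) ⟩
    P * image ε + r                              ∎

  image-upper : ∀ d e → p ^ d ≤ s ^ (d + e) → ∀ {k} (ε : Fin (suc k) → Fin s) → LeadingNonZero ε →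
                (P * image ε + r) ^ d ≤ Q ^ d * number ε ^ (d + e)
  -- The induction starts at one nonzero digit j; for the empty string the bound would read r ≤ 0.
  -- Here P(qj+r) + r = qPj + pr ≤ Qj because j ≥ 1.
  image-upper d e p^d≤s^c {zero} ε lead = begin
    (P * image ε + r) ^ d                  ≤⟨ ℕ.^-monoˡ-≤ d one-digit ⟩
    (Q * j) ^ d                            ≡⟨ ^-distribʳ-* d Q j ⟩
    Q ^ d * j ^ d                          ≤⟨ ℕ.*-monoʳ-≤ (Q ^ d) (ℕ.^-monoʳ-≤ j {{≢-nonZero lead}} (ℕ.m≤m+n d e)) ⟩
    Q ^ d * j ^ (d + e)                    ≡⟨ cong (λ z → Q ^ d * z ^ (d + e)) (trans (solve 2 (λ x s → x := x :+ s :* con 0) refl j s) (sym (number-suc ε))) ⟩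
    Q ^ d * number ε ^ (d + e)              ∎
    where
    j = toℕ (ε zero)
    one-digit : P * image ε + r ≤ Q * j
    one-digit = begin
      P * image ε + r                            ≡⟨ cong (λ z → P * z + r) (image-suc ε) ⟩
      P * (h (ε zero) + p * 0) + r               ≡⟨ cong (λ z → P * (z + p * 0) + r) (h≡ (ε zero)) ⟩
      P * (q * j + r + p * 0) + r                ≡⟨ solve 4 (λ P q j r → P :* (q :* j :+ r :+ (con 1 :+ P) :* con 0) :+ r := q :* P :* j :+ (con 1 :+ P) :* r :* con 1) refl P q j r ⟩
      q * P * j + p * r * 1                      ≤⟨ ℕ.+-monoʳ-≤ _ (ℕ.*-monoʳ-≤ (p * r) (ℕ.n≢0⇒n>0 lead)) ⟩
      q * P * j + p * r * j                      ≡⟨ sym (ℕ.*-distribʳ-+ j (q * P) (p * r)) ⟩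
      Q * j                                      ∎
  image-upper d e p^d≤s^c {suc k} ε lead = begin
    (P * image ε + r) ^ d                              ≡⟨ cong (λ z → (P * z + r) ^ d) (trans (image-suc ε) (cong (_+ p * a) (h≡ (ε zero)))) ⟩
    (P * (q * j + r + p * a) + r) ^ d                  ≡⟨ cong (_^ d) (solve 5 (λ P q j r a → P :* (q :* j :+ r :+ (con 1 :+ P) :* a) :+ r := (con 1 :+ P) :* (P :* a :+ r) :+ q :* P :* j) refl P q j r a) ⟩
    -- The digit adds only qP j; enlarging qP to `Q` gives the shape that `^-superadditive` accepts.
    (p * (P * a + r) + q * P * j) ^ d                  ≤⟨ ℕ.^-monoˡ-≤ d (ℕ.+-monoʳ-≤ (p * (P * a + r)) (ℕ.*-monoˡ-≤ j (ℕ.m≤m+n (q * P) (p * r)))) ⟩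
    (p * (P * a + r) + Q * j) ^ d                      ≤⟨ ^-superadditive d e j {{sn≢0}} scaled ⟩
    Q ^ d * (s * n + j) ^ (d + e)                      ≡⟨ cong (λ z → Q ^ d * z ^ (d + e)) (trans (ℕ.+-comm (s * n) j) (sym (number-suc ε))) ⟩
    Q ^ d * number ε ^ (d + e)                          ∎
    where
    j = toℕ (ε zero)
    n = number (ε ∘ suc)
    a = image (ε ∘ suc)
    sn≢0 : NonZero (s * n)
    sn≢0 = >-nonZero (ℕ.*-mono-≤ (>-nonZero⁻¹ s) (ℕ.≤-trans (ℕ.m^n>0 s k) (s^k≤number (ε ∘ suc) lead)))
    scaled : (p * (P * a + r)) ^ d ≤ Q ^ d * (s * n) ^ (d + e)
    scaled = begin
      (p * (P * a + r)) ^ d                    ≡⟨ ^-distribʳ-* d p (P * a + r) ⟩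
      p ^ d * (P * a + r) ^ d                  ≤⟨ ℕ.*-mono-≤ p^d≤s^c (image-upper d e p^d≤s^c (ε ∘ suc) lead) ⟩
      s ^ (d + e) * (Q ^ d * n ^ (d + e))      ≡⟨ solve 3 (λ x y z → x :* (y :* z) := y :* (x :* z)) refl (s ^ (d + e)) (Q ^ d) (n ^ (d + e)) ⟩
      Q ^ d * (s ^ (d + e) * n ^ (d + e))      ≡⟨ cong (Q ^ d *_) (sym (^-distribʳ-* (d + e) s n)) ⟩
      Q ^ d * (s * n) ^ (d + e)                ∎

-- Inequalities between rational powers read as inequalities between naturals.

^-cancelˡ-≤ : ∀ d .{{_ : NonZero d}} {x y} → x ^ d ≤ y ^ d → x ≤ y
^-cancelˡ-≤ d le = ℕ.≮⇒≥ λ y<x → ℕ.<⇒≱ (ℕ.^-monoˡ-< d y<x) le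

n<b^n : ∀ b n → 2 ≤ b → n < b ^ n
n<b^n b zero    2≤b = s≤s z≤n
n<b^n b (suc n) 2≤b = begin-strict
  suc n                 ≡⟨ ℕ.+-comm 1 n ⟩
  n + 1                 <⟨ ℕ.+-mono-<-≤ (n<b^n b n 2≤b) (ℕ.≤-trans (s≤s z≤n) (n<b^n b n 2≤b)) ⟩
  b ^ n + b ^ n         ≡⟨ solve 1 (λ x → x :+ x := con 2 :* x) refl (b ^ n) ⟩
  2 * b ^ n             ≤⟨ ℕ.*-monoˡ-≤ (b ^ n) 2≤b ⟩
  b * b ^ n             ∎

↥-* : ∀ x y → ↥ (x ℚ.* y) ≡ ↥ x ℤ.* ↥ y
↥-* (mkℚᵘ _ _) (mkℚᵘ _ _) = refl

↧-* : ∀ x y → ↧ₙ (x ℚ.* y) ≡ ↧ₙ x * ↧ₙ y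
↧-* (mkℚᵘ _ _) (mkℚᵘ _ _) = refl

↥-^ : ∀ Z δ d → ↥ (mkℚᵘ (+ Z) δ ^ℚ d) ≡ + (Z ^ d)
↥-^ Z δ zero    = refl
↥-^ Z δ (suc d) = trans (↥-* (mkℚᵘ (+ Z) δ) (mkℚᵘ (+ Z) δ ^ℚ d)) (trans (cong (+ Z ℤ.*_) (↥-^ Z δ d)) (sym (ℤ.pos-* Z (Z ^ d))))

↧-^ : ∀ Z δ d → ↧ₙ (mkℚᵘ (+ Z) δ ^ℚ d) ≡ suc δ ^ d
↧-^ Z δ zero    = refl
↧-^ Z δ (suc d) = trans (↧-* (mkℚᵘ (+ Z) δ) (mkℚᵘ (+ Z) δ ^ℚ d)) (cong (suc δ *_) (↧-^ Z δ d))

cross-≤ : ∀ {x y a b} → ↥ x ≡ + a → ↥ y ≡ + b → x ℚ.≤ y → a * ↧ₙ y ≤ b * ↧ₙ x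
cross-≤ {x} {y} {a} {b} x≡ y≡ (*≤* le) = ℤ.drop‿+≤+ (subst₂ ℤ._≤_
  (trans (cong (ℤ._* + ↧ₙ y) x≡) (sym (ℤ.pos-* a (↧ₙ y))))
  (trans (cong (ℤ._* + ↧ₙ x) y≡) (sym (ℤ.pos-* b (↧ₙ x)))) le)

*1^ : ∀ x k → x * 1 ^ k ≡ x
*1^ x k = trans (cong (x *_) (ℕ.^-zeroˡ k)) (ℕ.*-identityʳ x)

1^* : ∀ k x → 1 ^ k * x ≡ x
1^* k x = trans (ℕ.*-comm (1 ^ k) x) (*1^ x k)

-- The exponent c/d is nonnegative, so the factor n^(c⁻) is 1; clearing the denominators leaves
-- naturals.
^ʳ≤⇒ℕ : ∀ n c d-1 {Z δ} → n ^ʳ mkℚᵘ (+ c) d-1 ≤ mkℚᵘ (+ Z) δ →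
        suc δ ^ suc d-1 * n ^ c ≤ Z ^ suc d-1
^ʳ≤⇒ℕ n c d-1 {Z} {δ} (_ , le) = subst₂ _≤_
  (trans (cong (n ^ c *_) (↧-^ Z δ (suc d-1))) (ℕ.*-comm (n ^ c) _))
  (trans (cong (Z ^ suc d-1 *_) (↧-^ n 0 c)) (*1^ _ c))
  (cross-≤ (↥-^ n 0 c) (↥-^ Z δ (suc d-1)) (ℚ.≤-respʳ-≃ (ℚ.*-identityʳ (mkℚᵘ (+ Z) δ ^ℚ suc d-1)) le))

≤^ʳ⇒ℕ : ∀ n c d-1 {Z δ} .{{_ : NonZero Z}} → mkℚᵘ (+ Z) δ ≤ n ^ʳ mkℚᵘ (+ c) d-1 →
        Z ^ suc d-1 ≤ suc δ ^ suc d-1 * n ^ c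
≤^ʳ⇒ℕ _ _ _ {suc _} (inj₁ (*≤* (ℤ.+≤+ ())))
≤^ʳ⇒ℕ n c d-1 {Z} {δ} (inj₂ le) = subst₂ _≤_
  (trans (cong (Z ^ suc d-1 *_) (↧-^ n 0 c)) (*1^ _ c))
  (trans (cong (n ^ c *_) (↧-^ Z δ (suc d-1))) (ℕ.*-comm (n ^ c) _))
  (cross-≤ (↥-^ Z δ (suc d-1)) (↥-^ n 0 c) (ℚ.≤-respˡ-≃ (ℚ.*-identityʳ (mkℚᵘ (+ Z) δ ^ℚ suc d-1)) le))

data ≥1-View : ℚᵘ → Set where
  ratio : ∀ d-1 e → ≥1-View (mkℚᵘ (+ (suc d-1 + e)) d-1)

≥1-view : ∀ {w} → 1ℚᵘ ℚ.≤ w → ≥1-View w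
≥1-view {mkℚᵘ (+ c) d-1} (*≤* le)
  with ℕ.m≤n⇒∃[o]m+o≡n (ℤ.drop‿+≤+ (subst₂ ℤ._≤_ (ℤ.*-identityˡ (+ suc d-1)) (ℤ.*-identityʳ (+ c)) le))
... | e , refl = ratio d-1 e
≥1-view {mkℚᵘ -[1+ c ] d-1} (*≤* ())

data PosView : ℚᵘ → Set where
  pos : ∀ Z δ → PosView (mkℚᵘ (+ suc Z) δ)

pos-view : ∀ {z} → 0ℚᵘ ℚ.< z → PosView z
pos-view {mkℚᵘ (+ zero) δ}    (*<* (ℤ.+<+ ()))
pos-view {mkℚᵘ (+ suc Z) δ}   _ = pos Z δ
pos-view {mkℚᵘ -[1+ Z ] δ}    (*<* ())

-- Comparison of powers of s^k - 1 with powers of s^k.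

^-swap : ∀ a k d → (a ^ k) ^ d ≡ (a ^ d) ^ k
^-swap a k d = trans (ℕ.^-*-assoc a k d) (trans (cong (a ^_) (ℕ.*-comm k d)) (sym (ℕ.^-*-assoc a d k)))

-- `young` gives n^(V+1) ≥ (n-V)(n+1)^V, which reduces the claim to H(n+1) < G(n-V). This is linear
-- in `n` and holds once n ≥ G(V+1), since H+1 ≤ G. Subtractions are moved to the other side.
suc-^-gap : ∀ V {H G n} → H < G → G * suc V ≤ n → H * suc n ^ suc V < G * n ^ suc V
suc-^-gap V {H} {G} {n} H<G GW≤n = ℕ.+-cancelʳ-< (G * V * B) _ _ (begin-strict
  H * (suc n * B) + G * V * B       ≡⟨ solve 5 (λ H n B G V → H :* ((con 1 :+ n) :* B) :+ G :* V :* B := (H :* (con 1 :+ n) :+ G :* V) :* B) refl H n B G V ⟩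
  (H * suc n + G * V) * B           <⟨ ℕ.*-monoˡ-< B {{ℕ.m^n≢0 (suc n) V}} slope ⟩
  G * n * B                         ≡⟨ ℕ.*-assoc G n B ⟩
  G * (n * B)                       ≤⟨ ℕ.*-monoʳ-≤ G tangent-at-suc ⟩
  G * (n ^ suc V + V * B)           ≡⟨ solve 4 (λ G x V B → G :* (x :+ V :* B) := G :* x :+ G :* V :* B) refl G (n ^ suc V) V B ⟩
  G * n ^ suc V + G * V * B         ∎)
  where
  B = suc n ^ V

  tangent-at-suc : n * B ≤ n ^ suc V + V * B
  tangent-at-suc = ℕ.+-cancelʳ-≤ (V * (n * B)) _ _ (begin
    n * B + V * (n * B)                 ≤⟨ young V n (suc n) ⟩
    n ^ suc V + V * (suc n * B)         ≡⟨ solve 4 (λ x V n B → x :+ V :* ((con 1 :+ n) :* B) := x :+ V :* B :+ V :* (n :* B)) refl (n ^ suc V) V n B ⟩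
    n ^ suc V + V * B + V * (n * B)     ∎)

  slope : H * suc n + G * V < G * n
  slope = ℕ.+-cancelʳ-≤ G _ _ (begin
    suc (H * suc n + G * V) + G         ≡⟨ solve 4 (λ H n G V → con 1 :+ (H :* (con 1 :+ n) :+ G :* V) :+ G := H :* (con 1 :+ n) :+ (con 1 :+ G :* (con 1 :+ V))) refl H n G V ⟩
    H * suc n + suc (G * suc V)         ≤⟨ ℕ.+-monoʳ-≤ (H * suc n) (s≤s GW≤n) ⟩
    H * suc n + suc n                   ≡⟨ ℕ.+-comm (H * suc n) (suc n) ⟩
    suc H * suc n                       ≤⟨ ℕ.*-monoˡ-≤ (suc n) H<G ⟩
    G * suc n                           ≡⟨ trans (ℕ.*-suc G n) (ℕ.+-comm G (G * n)) ⟩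
    G * n + G                           ∎)

-- One integer exponent `W` serves every c/d ≥ log_s p at once. If c/d ≥ W, then p^k ≤ N^W, and n^W
-- ≤ n^(c/d). If c/d ≤ W, then p^k ≤ N^(c/d), and (N/n)^(c/d) ≤ (N/n)^W because n ≤ N; here `f` is
-- the excess Wd - c.
near-power : ∀ d c W k {s p H G n} .{{_ : NonZero d}} .{{_ : NonZero n}} →
             p ^ d ≤ s ^ c → p ≤ s ^ W → n ≤ s ^ k → H * (s ^ k) ^ W < G * n ^ W →
             (H * p ^ k) ^ d < G ^ d * n ^ c
near-power d c W k {s} {p} {H} {G} {n} p^d≤s^c p≤s^W n≤N gap with ℕ.≤-total (W * d) c
... | inj₁ Wd≤c = begin-strict
  (H * p ^ k) ^ d             ≤⟨ ℕ.^-monoˡ-≤ d (ℕ.*-monoʳ-≤ H (ℕ.^-monoˡ-≤ k p≤s^W)) ⟩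
  (H * (s ^ W) ^ k) ^ d       ≡⟨ cong (λ z → (H * z) ^ d) (^-swap s W k) ⟩
  (H * (s ^ k) ^ W) ^ d       <⟨ ℕ.^-monoˡ-< d gap ⟩
  (G * n ^ W) ^ d             ≡⟨ ^-distribʳ-* d G (n ^ W) ⟩
  G ^ d * (n ^ W) ^ d         ≡⟨ cong (G ^ d *_) (ℕ.^-*-assoc n W d) ⟩
  G ^ d * n ^ (W * d)         ≤⟨ ℕ.*-monoʳ-≤ (G ^ d) (ℕ.^-monoʳ-≤ n Wd≤c) ⟩
  G ^ d * n ^ c               ∎
... | inj₂ c≤Wd with ℕ.m≤n⇒∃[o]m+o≡n c≤Wd
...   | f , c+f≡Wd = ℕ.*-cancelʳ-< (N ^ f) _ _ (begin-strict
  (H * p ^ k) ^ d * N ^ f       ≡⟨ cong (_* N ^ f) (^-distribʳ-* d H (p ^ k)) ⟩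
  H ^ d * (p ^ k) ^ d * N ^ f   ≡⟨ cong (λ z → H ^ d * z * N ^ f) (^-swap p k d) ⟩
  H ^ d * (p ^ d) ^ k * N ^ f   ≤⟨ ℕ.*-monoˡ-≤ (N ^ f) (ℕ.*-monoʳ-≤ (H ^ d) (ℕ.^-monoˡ-≤ k p^d≤s^c)) ⟩
  H ^ d * (s ^ c) ^ k * N ^ f   ≡⟨ cong (λ z → H ^ d * z * N ^ f) (^-swap s c k) ⟩
  H ^ d * N ^ c * N ^ f         ≡⟨ trans (ℕ.*-assoc (H ^ d) _ _) (cong (H ^ d *_) (split N)) ⟩
  H ^ d * (N ^ W) ^ d           ≡⟨ sym (^-distribʳ-* d H (N ^ W)) ⟩
  (H * N ^ W) ^ d               <⟨ ℕ.^-monoˡ-< d gap ⟩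
  (G * n ^ W) ^ d               ≡⟨ ^-distribʳ-* d G (n ^ W) ⟩
  G ^ d * (n ^ W) ^ d           ≡⟨ trans (cong (G ^ d *_) (sym (split n))) (sym (ℕ.*-assoc (G ^ d) _ _)) ⟩
  G ^ d * n ^ c * n ^ f         ≤⟨ ℕ.*-monoʳ-≤ (G ^ d * n ^ c) (ℕ.^-monoˡ-≤ f n≤N) ⟩
  G ^ d * n ^ c * N ^ f         ∎)
  where
  N = s ^ k
  split : ∀ x → x ^ c * x ^ f ≡ (x ^ W) ^ d
  split x = trans (sym (ℕ.^-distribˡ-+-* x c f)) (trans (cong (x ^_) c+f≡Wd) (sym (ℕ.^-*-assoc x W d)))

-- The cuts of n^(log_s p) and of quotients by it.

cross-< : ∀ {a b c d} → mkℚᵘ (+ a) b ℚ.< mkℚᵘ (+ c) d → a * suc d < c * suc b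
cross-< {a} {b} {c} {d} (*<* lt) = ℤ.drop‿+<+ (subst₂ ℤ._<_ (sym (ℤ.pos-* a (suc d))) (sym (ℤ.pos-* c (suc b))) lt)

mk-< : ∀ {a b c d} → a * suc d < c * suc b → mkℚᵘ (+ a) b ℚ.< mkℚᵘ (+ c) d
mk-< {a} {b} {c} {d} lt = *<* (subst₂ ℤ._<_ (ℤ.pos-* a (suc d)) (ℤ.pos-* c (suc b)) (ℤ.+<+ lt))

module Power {s p : ℕ} (2≤s : 2 ≤ s) (s<p : s < p) (1≤p : 1 ≤ p) {n : ℕ} (1≤n : 1 ≤ n) where

  n^logₛp : ℝ
  n^logₛp = pow n 1≤n (log s p 2≤s 1≤p)

  1≤s : 1 ≤ s
  1≤s = ℕ.≤-trans (s≤s z≤n) 2≤s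

  s^1≤ : ∀ {x} → s ≤ x → s ^ʳ 1ℚᵘ ≤ (+ x / 1)
  s^1≤ {x} s≤x = ℚ.<-≤-trans 0<1 (ι-mono (ℕ.≤-trans 1≤s s≤x)) ,
    ℚ.≤-trans (ℚ.≤-reflexive (ℚ.*-identityʳ (+ s / 1))) (ℚ.≤-trans (ι-mono s≤x)
      (ℚ.≤-reflexive (ℚ.≃-sym (ℚ.≃-trans (ℚ.*-identityʳ _) (ℚ.*-identityʳ (+ x / 1))))))

  private
    L⇒ : ∀ {Z δ y v w} → mkℚᵘ (+ suc Z) δ ℚ.< y → v ℚ.< w → 1ℚᵘ ℚ.≤ w →
         y ≤ n ^ʳ v → s ^ʳ w ≤ (+ p / 1) →
         ∃₂ λ d e → s ^ (suc d + e) ≤ p ^ suc d × suc Z ^ suc d ≤ suc δ ^ suc d * n ^ (suc d + e)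
    L⇒ {Z} {δ} {y} {v} {w} z<y v<w 1≤w y≤n^v s^w≤p with ≥1-view 1≤w | ^ʳ-total n w {mkℚᵘ (+ suc Z) δ} (*<* (ℤ.+<+ (s≤s z≤n)))
    ... | ratio d-1 e | inj₁ z≤n^w = d-1 , e ,
            subst (_≤ p ^ suc d-1) (1^* (suc d-1) (s ^ (suc d-1 + e))) (^ʳ≤⇒ℕ s (suc d-1 + e) d-1 {p} s^w≤p) , ≤^ʳ⇒ℕ n (suc d-1 + e) d-1 z≤n^w
    ... | ratio d-1 e | inj₂ n^w≤z = ⊥-elim (ℚ.<-irrefl ℚ.≃-refl (ℚ.<-≤-trans z<y
            (^ʳ-mono v _ 1≤n (ℚ.<⇒≤ v<w) y≤n^v n^w≤z)))

  -- Unpacks the cut into an exponent (d+e)/d ≤ log_s p with Z/D ≤ n^((d+e)/d), where D = `suc δ`.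
  -- If the exponent found in the cut is below 1, it is replaced by 1, which is admissible because s
  -- ≤ p.
  L-pow⇒ : ∀ {Z δ} → L n^logₛp (mkℚᵘ (+ suc Z) δ) →
    ∃₂ λ d e → s ^ (suc d + e) ≤ p ^ suc d × suc Z ^ suc d ≤ suc δ ^ suc d * n ^ (suc d + e)
  L-pow⇒ (y , z<y , v , (w , v<w , s^w≤p) , y≤n^v) with 1ℚᵘ ℚ.≤? w
  ... | yes 1≤w = L⇒ z<y v<w 1≤w y≤n^v s^w≤p
  ... | no  1≰w = L⇒ z<y (ℚ.<-trans v<w (ℚ.≰⇒> 1≰w)) ℚ.≤-refl y≤n^v (s^1≤ (ℕ.<⇒≤ s<p))

  U-pow-positive : ∀ {z} → U n^logₛp z → 0ℚᵘ ℚ.< z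
  U-pow-positive (y , y<z , v , _ , (0<y , _)) = ℚ.<-trans 0<y y<z

  U-pow⇒ : ∀ {Z δ} → U n^logₛp (mkℚᵘ (+ Z) δ) →
    ∃₂ λ d e → p ^ suc d ≤ s ^ (suc d + e) × suc δ ^ suc d * n ^ (suc d + e) ≤ Z ^ suc d
  U-pow⇒ {Z} {δ} Uz@(y , y<z , v , (w , w<v , p≤s^w) , n^v≤y)
    with 1ℚᵘ ℚ.≤? w
  -- An exponent below 1 with p ≤ s^w would give p ≤ s.
  ... | no 1≰w = contradiction (ℚ.<-≤-trans (ι-mono-< s<p) (^ʳ-mono w 1ℚᵘ 1≤s (ℚ.<⇒≤ (ℚ.≰⇒> 1≰w)) p≤s^w (s^1≤ ℕ.≤-refl)))
                   (ℚ.<-irrefl ℚ.≃-refl)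
  ... | yes 1≤w with ≥1-view 1≤w | ^ʳ-total n w {mkℚᵘ (+ Z) δ} (U-pow-positive Uz)
  ...   | ratio d-1 e | inj₂ n^w≤z = d-1 , e ,
          subst (p ^ suc d-1 ≤_) (1^* (suc d-1) (s ^ (suc d-1 + e))) (≤^ʳ⇒ℕ s (suc d-1 + e) d-1 {{>-nonZero 1≤p}} p≤s^w) , ^ʳ≤⇒ℕ n (suc d-1 + e) d-1 n^w≤z
  ...   | ratio d-1 e | inj₁ z≤n^w = ⊥-elim (ℚ.<-irrefl ℚ.≃-refl (ℚ.<-≤-trans y<z
          (^ʳ-mono w v 1≤n (ℚ.<⇒≤ w<v) z≤n^w n^v≤y)))

  -- Membership in the cut asks for explicit exponents; locatedness supplies them once the opposite
  -- cut is refuted at a slightly larger rational.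
  L-pow⇐ : ∀ {z z′} → z ℚ.< z′ → ¬ U n^logₛp z′ → L n^logₛp z
  L-pow⇐ z<z′ ¬Uz′ with located n^logₛp z<z′
  ... | inj₁ Lz  = Lz
  ... | inj₂ Uz′ = contradiction Uz′ ¬Uz′

  U-pow⇐ : ∀ {z z′} → z ℚ.< z′ → ¬ L n^logₛp z → U n^logₛp z′
  U-pow⇐ z<z′ ¬Lz with located n^logₛp z<z′
  ... | inj₁ Lz  = contradiction Lz ¬Lz
  ... | inj₂ Uz′ = Uz′

  -- log_s p ≤ p, so comparing p-th powers controls all exponents that matter.
  ¬U-near : ∀ k {H γ} → suc n ≡ s ^ k → H * suc n ^ p < suc γ * n ^ p → ¬ U n^logₛp (mkℚᵘ (+ (H * p ^ k)) γ)
  ¬U-near k {H} {γ} n≡ gap Uz with U-pow⇒ Uz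
  ... | d , e , p^d≤s^c , G^dn^c≤ = ℕ.<⇒≱
    (near-power (suc d) (suc d + e) p k {H = H} {{_}} {{>-nonZero 1≤n}} p^d≤s^c (ℕ.<⇒≤ (n<b^n s p 2≤s))
      (ℕ.≤-trans (ℕ.n≤1+n n) (ℕ.≤-reflexive n≡))
      (subst (λ N → H * N ^ p < suc γ * n ^ p) n≡ gap))
    G^dn^c≤

  -- The half (s^k)^(log_s p) ≤ p^k: for s^c ≤ p^d, (s^k)^c = (s^c)^k ≤ (p^k)^d.
  ¬L-power : ∀ k {z} → n ≡ s ^ k → + (p ^ k) / 1 ℚ.< z → ¬ L n^logₛp z
  ¬L-power k {z} n≡ p^k<z Lz with pos-view (ℚ.≤-<-trans (0≤ι (p ^ k)) p^k<z)
  ... | pos Z δ with L-pow⇒ Lz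
  ...   | d , e , s^c≤p^d , Z^d≤ = ℚ.<-irrefl ℚ.≃-refl (ℚ.<-≤-trans p^k<z
    (*≤* (subst₂ ℤ._≤_ (sym (ℤ.*-identityʳ _)) (ℤ.pos-* (p ^ k) (suc δ)) (ℤ.+≤+ (^-cancelˡ-≤ (suc d) (begin
      suc Z ^ suc d                           ≤⟨ Z^d≤ ⟩
      suc δ ^ suc d * n ^ (suc d + e)         ≡⟨ cong (λ x → suc δ ^ suc d * x ^ (suc d + e)) n≡ ⟩
      suc δ ^ suc d * (s ^ k) ^ (suc d + e)   ≡⟨ cong (suc δ ^ suc d *_) (^-swap s k (suc d + e)) ⟩
      suc δ ^ suc d * (s ^ (suc d + e)) ^ k   ≤⟨ ℕ.*-monoʳ-≤ (suc δ ^ suc d) (ℕ.^-monoˡ-≤ k s^c≤p^d) ⟩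
      suc δ ^ suc d * (p ^ suc d) ^ k         ≡⟨ ℕ.*-comm (suc δ ^ suc d) _ ⟩
      (p ^ suc d) ^ k * suc δ ^ suc d         ≡⟨ cong (_* suc δ ^ suc d) (^-swap p (suc d) k) ⟩
      (p ^ k) ^ suc d * suc δ ^ suc d         ≡⟨ sym (^-distribʳ-* (suc d) (p ^ k) (suc δ)) ⟩
      (p ^ k * suc δ) ^ suc d                 ∎))))))

  module Ratio (a P-1 : ℕ) (0<pow : fromℕ 0 <ᴿ n^logₛp) where
    private
      P = suc P-1

    -- If a/y < μ/P, the quotient cut yields x < μ/P and a positive z < y with a ≤ xz. So it
    -- suffices that (μ/P) z ≤ a for all z = Z/D below a power n^((d+e)/d) with (d+e)/d ≤ log_s p.
    ratio-≥ : ∀ {μ} →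
      (∀ d e Z D .{{_ : NonZero d}} → s ^ (d + e) ≤ p ^ d → Z ^ d ≤ D ^ d * n ^ (d + e) → μ * Z ≤ a * (P * D)) →
      fromℚ (mkℚᵘ (+ μ) P-1) ≤ᴿ quotient a n^logₛp 0<pow
    ratio-≥ {μ} bound (g , (x , x<g , z , Lz , 0<z , a≤xz) , g<m) with pos-view 0<z
    ... | pos Z δ with L-pow⇒ Lz
    ...   | d , e , s^c≤p^d , Z^d≤ = ℚ.<-irrefl ℚ.≃-refl (ℚ.≤-<-trans a≤xz (ℚ.<-≤-trans
      (*-monoˡ-< (mkℚᵘ (+ suc Z) δ) 0<z (ℚ.<-trans x<g g<m))
      (*≤* (subst₂ ℤ._≤_ (trans (ℤ.pos-* μ (suc Z)) (sym (ℤ.*-identityʳ _))) (ℤ.pos-* a _)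
        (ℤ.+≤+ (bound (suc d) e (suc Z) (suc δ) s^c≤p^d Z^d≤))))))

    ratio-≤ : ∀ {Q} →
      (∀ d e Z D .{{_ : NonZero d}} → p ^ d ≤ s ^ (d + e) → D ^ d * n ^ (d + e) ≤ Z ^ d → a * (P * D) ≤ Q * Z) →
      quotient a n^logₛp 0<pow ≤ᴿ fromℚ (mkℚᵘ (+ Q) P-1)
    ratio-≤ {Q} bound (g , M<g , (x , g<x , z , Uz , xz≤a)) with pos-view (U-pow-positive Uz)
    ... | pos Z δ with U-pow⇒ Uz
    ...   | d , e , p^d≤s^c , ≤Z^d = ℚ.<-irrefl ℚ.≃-refl (ℚ.≤-<-trans
      (*≤* (subst₂ ℤ._≤_ (ℤ.pos-* a _) (trans (ℤ.pos-* Q (suc Z)) (sym (ℤ.*-identityʳ _)))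
        (ℤ.+≤+ (bound (suc d) e (suc Z) (suc δ) p^d≤s^c ≤Z^d))))
      (ℚ.<-≤-trans (*-monoˡ-< (mkℚᵘ (+ suc Z) δ) (*<* (ℤ.+<+ (s≤s z≤n))) (ℚ.<-trans M<g g<x)) xz≤a))

-- The two bounds for b_n and their sharpness.

module Residues (q r P-1 : ℕ) (2≤q : 2 ≤ q) (r<q : r < q) (q+r<p : q + r < suc (suc P-1)) where

  P = suc P-1

  A = residues q r (suc P)
  s = ∣ A ∣
  2≤s = 2≤∣residues∣ 2≤q q+r<p
  1≤p = ℕ.≤-trans (ℕ.n≤1+n 1) (ℕ.≤-trans 2≤s (∣p∣≤n A))
  b = bSeq A 2≤s

  open Digits {s} {P} {q} {r} 2≤s 2≤q (∣p∣≤n A) (λ i → toℕ (enum A i)) (enum-residues r<q)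

  -- The top digit q(s-1) + r is below `p`, and it is at least 2(s-1) ≥ s. Strictness makes log_s p
  -- exceed 1, hence the exponents (d+e)/d.
  s<p : s < p
  s<p = begin-strict
    s                               ≡⟨ sym (ℕ.m∸n+n≡m 1≤s) ⟩
    s ∸ 1 + 1                       ≤⟨ ℕ.+-monoʳ-≤ (s ∸ 1) (ℕ.m<n⇒0<n∸m 2≤s) ⟩
    s ∸ 1 + (s ∸ 1)                 ≡⟨ solve 1 (λ x → x :+ x := con 2 :* x) refl (s ∸ 1) ⟩
    2 * (s ∸ 1)                     ≤⟨ ℕ.*-monoˡ-≤ (s ∸ 1) 2≤q ⟩
    q * (s ∸ 1)                     ≤⟨ ℕ.m≤m+n _ r ⟩
    q * (s ∸ 1) + r                 ≡⟨ cong (λ i → q * i + r) (sym (Fin.toℕ-fromℕ< s-1<s)) ⟩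
    q * toℕ (Fin.fromℕ< s-1<s) + r  ≡⟨ sym (enum-residues r<q (Fin.fromℕ< s-1<s)) ⟩
    toℕ (enum A (Fin.fromℕ< s-1<s)) <⟨ Fin.toℕ<n (enum A (Fin.fromℕ< s-1<s)) ⟩
    p                               ∎
    where
    1≤s = ℕ.≤-trans (ℕ.n≤1+n 1) 2≤s
    s-1<s : s ∸ 1 < s
    s-1<s = ℕ.≤-reflexive (trans (ℕ.+-comm 1 (s ∸ 1)) (ℕ.m∸n+n≡m 1≤s))

  m M : ℚᵘ
  m = mkℚᵘ (+ μ) P-1
  M = mkℚᵘ (+ Q) P-1

  module _ (n : ℕ) (1≤n : 1 ≤ n) where
    open Expansion (expansion s n 2≤s 1≤n)
    open Power 2≤s s<p 1≤p 1≤n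
    open Ratio (aSeq A 2≤s (n , 1≤n)) P-1 (pow-positive n 1≤n (logₛp A 2≤s))

    private
      a = aSeq A 2≤s (n , 1≤n)

    m≤b : fromℚ m ≤ᴿ b (n , 1≤n)
    m≤b = ratio-≥ λ d e Z D s^c≤p^d Z^d≤ → ℕ.+-cancelʳ-≤ (μ * D) _ _ (begin
      μ * Z + μ * D          ≤⟨ ^-cancelˡ-≤ d (scaled d e Z D s^c≤p^d Z^d≤) ⟩
      D * (P * a + μ)        ≡⟨ solve 4 (λ D P a m → D :* (P :* a :+ m) := a :* (P :* D) :+ m :* D) refl D P a μ ⟩
      a * (P * D) + μ * D    ∎)
      where
      scaled : ∀ d e Z D → s ^ (d + e) ≤ p ^ d → Z ^ d ≤ D ^ d * n ^ (d + e) → (μ * Z + μ * D) ^ d ≤ (D * (P * a + μ)) ^ d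
      scaled d e Z D s^c≤p^d Z^d≤ = begin
        (μ * Z + μ * D) ^ d                    ≡⟨ cong (_^ d) (solve 3 (λ m Z D → m :* Z :+ m :* D := m :* (Z :+ D :* con 1)) refl μ Z D) ⟩
        (μ * (Z + D * 1)) ^ d                  ≡⟨ ^-distribʳ-* d μ (Z + D * 1) ⟩
        -- `^-superadditive` with `Q := D` and j = 1: from Z/D ≤ n^((d+e)/d) follows Z/D + 1 ≤
        -- (n+1)^((d+e)/d).
        μ ^ d * (Z + D * 1) ^ d                ≤⟨ ℕ.*-monoʳ-≤ (μ ^ d) (^-superadditive d e 1 {{>-nonZero 1≤n}} Z^d≤) ⟩
        μ ^ d * (D ^ d * (n + 1) ^ (d + e))    ≡⟨ solve 3 (λ x y z → x :* (y :* z) := y :* (x :* z)) refl (μ ^ d) (D ^ d) _ ⟩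
        D ^ d * (μ ^ d * (n + 1) ^ (d + e))    ≡⟨ cong (λ x → D ^ d * (μ ^ d * x ^ (d + e))) (trans (ℕ.+-comm n 1) (cong suc (sym value))) ⟩
        D ^ d * (μ ^ d * suc (number ε) ^ (d + e))  ≤⟨ ℕ.*-monoʳ-≤ (D ^ d) (image-lower d e s^c≤p^d ε) ⟩
        D ^ d * (P * a + μ) ^ d                ≡⟨ sym (^-distribʳ-* d D (P * a + μ)) ⟩
        (D * (P * a + μ)) ^ d                  ∎

    b≤M : b (n , 1≤n) ≤ᴿ fromℚ M
    b≤M = ratio-≤ λ d e Z D p^d≤s^c ≤Z^d → ^-cancelˡ-≤ d (begin
      (a * (P * D)) ^ d                    ≤⟨ ℕ.^-monoˡ-≤ d (ℕ.m≤m+n _ (D * r)) ⟩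
      (a * (P * D) + D * r) ^ d            ≡⟨ cong (_^ d) (solve 4 (λ a P D r → a :* (P :* D) :+ D :* r := D :* (P :* a :+ r)) refl a P D r) ⟩
      (D * (P * a + r)) ^ d                ≡⟨ ^-distribʳ-* d D (P * a + r) ⟩
      D ^ d * (P * a + r) ^ d              ≤⟨ ℕ.*-monoʳ-≤ (D ^ d) (image-upper d e p^d≤s^c ε leading) ⟩
      D ^ d * (Q ^ d * number ε ^ (d + e))  ≡⟨ cong (λ x → D ^ d * (Q ^ d * x ^ (d + e))) value ⟩
      D ^ d * (Q ^ d * n ^ (d + e))        ≡⟨ solve 3 (λ x y z → x :* (y :* z) := y :* (x :* z)) refl (D ^ d) (Q ^ d) _ ⟩
      Q ^ d * (D ^ d * n ^ (d + e))        ≤⟨ ℕ.*-monoʳ-≤ (Q ^ d) ≤Z^d ⟩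
      Q ^ d * Z ^ d                        ≡⟨ sym (^-distribʳ-* d Q Z) ⟩
      (Q * Z) ^ d                          ∎)

    a-at-s^k-1 : ∀ k → suc n ≡ s ^ k → P * a ≤ μ * p ^ k
    a-at-s^k-1 j 1+n≡s^j = begin
      P * a               ≤⟨ ℕ.m≤m+n _ μ ⟩
      P * a + μ           ≤⟨ image-≤ ε ⟩
      μ * p ^ suc k       ≤⟨ ℕ.*-monoʳ-≤ μ (ℕ.^-monoʳ-≤ p k<j) ⟩
      μ * p ^ j           ∎
      where
      -- The nonzero leading digit gives s^k ≤ n < s^j, so the expansion has at most j digits.
      k<j : k < j
      k<j = ℕ.≰⇒> λ j≤k → ℕ.<⇒≱ (ℕ.n<1+n n) (ℕ.≤-trans (ℕ.≤-reflexive 1+n≡s^j)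
              (ℕ.≤-trans (ℕ.^-monoʳ-≤ s j≤k) (ℕ.≤-trans (s^k≤number ε leading) (ℕ.≤-reflexive value))))

    a-at-s^k : ∀ k → n ≡ s ^ k → Q * p ^ k ≤ P * a + r
    a-at-s^k j n≡s^j = ℕ.≤-trans (ℕ.*-monoʳ-≤ Q (ℕ.^-monoʳ-≤ p j≤k)) (image-≥ ε leading)
      where
      -- With k+1 digits, s^j = n < s^(k+1).
      j≤k : j ≤ k
      j≤k = ℕ.≮⇒≥ λ k<j → ℕ.<⇒≱ (number<s^k ε)
              (ℕ.≤-trans (ℕ.^-monoʳ-≤ s k<j) (ℕ.≤-reflexive (trans (sym n≡s^j) (sym value))))

  inf-approached : ∀ x → fromℚ m <ᴿ x → ∃ λ i → b i <ᴿ x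
  inf-approached x (g , m<g , Lg) with ℚ.<-dense m<g
  ... | x₀ , m<x₀ , x₀<g with pos-view (ℚ.≤-<-trans (*≤* (subst₂ ℤ._≤_ refl (sym (ℤ.*-identityʳ (+ μ))) (ℤ.+≤+ z≤n))) m<x₀)
  ...   | pos X E-1 = result (ℕ.m≤n⇒∃[o]m+o≡n (ℕ.m^n>0 s k))
    where
    -- With x₀ = X₁/E, where X₁ = `suc X`, F/G equals m/x₀, so z = (F/G) p^k satisfies x₀ z = m p^k
    -- ≥ a. The factor 2 turns μE < X₁P into F < H < G, leaving room for `H` between the point to be
    -- placed in `L` and the one excluded from `U`. The choice k = Gp makes n = s^k - 1 ≥ Gp, as
    -- `suc-^-gap` requires for p-th powers.
    E F G H k : ℕ
    E = suc E-1
    F = 2 * (μ * E)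
    G = 2 * (suc X * P)
    H = suc F
    k = G * p

    H<G : H < G
    H<G = begin
      2 + F                 ≡⟨ sym (ℕ.*-suc 2 (μ * E)) ⟩
      2 * suc (μ * E)       ≤⟨ ℕ.*-monoʳ-≤ 2 (cross-< m<x₀) ⟩
      G                     ∎

    result : (∃ λ n → suc n ≡ s ^ k) → ∃ λ i → b i <ᴿ x
    result (n , 1+n≡s^k) = (n , 1≤n) , g , (mkℚᵘ (+ suc X) E-1 , x₀<g , z , Lz , 0<z , a≤x₀z) , Lg
      where
      k≤n : k ≤ n
      k≤n = s≤s⁻¹ (ℕ.≤-trans (n<b^n s k 2≤s) (ℕ.≤-reflexive (sym 1+n≡s^k)))

      1≤n : 1 ≤ n
      1≤n = ℕ.≤-trans (s≤s z≤n) k≤n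

      open Power 2≤s s<p 1≤p 1≤n

      a = aSeq A 2≤s (n , 1≤n)
      z = mkℚᵘ (+ (F * p ^ k)) (pred G)

      0<z : 0ℚᵘ ℚ.< z
      0<z = mk-< (ℕ.≤-trans (ℕ.*-mono-≤ {1} {F} (ℕ.*-mono-≤ {1} {2} (s≤s z≤n) (ℕ.*-mono-≤ (>-nonZero⁻¹ μ) (s≤s {n = E-1} z≤n))) (ℕ.m^n>0 p k))
        (ℕ.≤-reflexive (sym (ℕ.*-identityʳ _))))

      Lz : L n^logₛp z
      Lz = L-pow⇐ (mk-< (ℕ.*-monoˡ-< G (ℕ.*-monoˡ-< (p ^ k) {{ℕ.m^n≢0 p k}} (ℕ.n<1+n F))))
             (¬U-near k {H} {pred G} 1+n≡s^k (suc-^-gap P H<G k≤n))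

      a≤x₀z : (+ a / 1) ℚ.≤ mkℚᵘ (+ suc X) E-1 ℚ.* z
      a≤x₀z = *≤* (subst₂ ℤ._≤_ (ℤ.pos-* a (E * G)) (trans (ℤ.pos-* (suc X) (F * p ^ k)) (sym (ℤ.*-identityʳ _))) (ℤ.+≤+ (begin
        a * (E * G)                       ≡⟨ solve 4 (λ a E X P → a :* (E :* (con 2 :* (X :* P))) := con 2 :* E :* X :* (P :* a)) refl a E (suc X) P ⟩
        2 * E * suc X * (P * a)           ≤⟨ ℕ.*-monoʳ-≤ (2 * E * suc X) (a-at-s^k-1 n 1≤n k 1+n≡s^k) ⟩
        2 * E * suc X * (μ * p ^ k)       ≡⟨ solve 4 (λ E X m x → con 2 :* E :* X :* (m :* x) := X :* (con 2 :* (m :* E) :* x)) refl E (suc X) μ (p ^ k) ⟩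
        suc X * (F * p ^ k)               ∎)))

  0<M : 0ℚᵘ ℚ.< M
  0<M = mk-< (ℕ.≤-trans (ℕ.≤-trans (ℕ.*-mono-≤ {1} {q} {1} {P} (ℕ.≤-trans (s≤s z≤n) 2≤q) (s≤s z≤n)) (ℕ.m≤m+n (q * P) (p * r)))
          (ℕ.≤-reflexive (sym (ℕ.*-identityʳ Q))))

  sup-approached-from : ∀ {x g} → U x g → ∀ {x₀} → g ℚ.< x₀ → 0ℚᵘ ℚ.< x₀ → x₀ ℚ.< M → ∃ λ i → x <ᴿ b i
  sup-approached-from {x} {g} Ug g<x₀ 0<x₀ x₀<M with pos-view 0<x₀
  ... | pos X E-1 = (n , 1≤n) , g , Ug , (mkℚᵘ (+ suc X) E-1 , g<x₀ , z , Uz , x₀z≤a)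
    where
    -- Here z = a/x₀ exactly, and p^k < z is wanted. From X₁P + 1 ≤ QE, with X₁ = `suc X`, one copy
    -- of p^k is spare, and k = rE makes it exceed the error term rE.
    E k n : ℕ
    E = suc E-1
    k = r * E
    n = s ^ k

    1≤n : 1 ≤ n
    1≤n = ℕ.m^n>0 s k

    open Power 2≤s s<p 1≤p 1≤n

    a = aSeq A 2≤s (n , 1≤n)
    z = mkℚᵘ (+ (a * E)) X

    p^k*X<a*E : p ^ k * suc X < a * E
    p^k*X<a*E = ℕ.*-cancelˡ-< P _ _ (ℕ.+-cancelʳ-< (r * E) _ _ (begin-strict
      P * (p ^ k * suc X) + r * E       <⟨ ℕ.+-monoʳ-< _ (n<b^n p k (ℕ.≤-trans 2≤s (ℕ.<⇒≤ s<p))) ⟩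
      P * (p ^ k * suc X) + p ^ k       ≡⟨ solve 3 (λ P x X → P :* (x :* X) :+ x := (con 1 :+ X :* P) :* x) refl P (p ^ k) (suc X) ⟩
      suc (suc X * P) * p ^ k           ≤⟨ ℕ.*-monoˡ-≤ (p ^ k) (cross-< x₀<M) ⟩
      Q * E * p ^ k                     ≡⟨ solve 3 (λ Q E x → Q :* E :* x := Q :* x :* E) refl Q E (p ^ k) ⟩
      Q * p ^ k * E                     ≤⟨ ℕ.*-monoˡ-≤ E (a-at-s^k n 1≤n k refl) ⟩
      (P * a + r) * E                   ≡⟨ solve 4 (λ P a r E → (P :* a :+ r) :* E := P :* (a :* E) :+ r :* E) refl P a r E ⟩
      P * (a * E) + r * E               ∎))

    Uz : U n^logₛp z
    Uz = let (z′ , p^k<z′ , z′<z) = ℚ.<-dense (mk-< {p ^ k} {0} {a * E} {X} (ℕ.≤-trans p^k*X<a*E (ℕ.≤-reflexive (sym (ℕ.*-identityʳ _)))))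
         in U-pow⇐ z′<z (¬L-power k refl p^k<z′)

    x₀z≤a : mkℚᵘ (+ suc X) E-1 ℚ.* z ℚ.≤ (+ a / 1)
    x₀z≤a = *≤* (subst₂ ℤ._≤_ (trans (ℤ.pos-* (suc X) (a * E)) (sym (ℤ.*-identityʳ _))) (ℤ.pos-* a (E * suc X)) (ℤ.+≤+
      (ℕ.≤-reflexive (solve 3 (λ X a E → X :* (a :* E) := a :* (E :* X)) refl (suc X) a E))))

  sup-approached : ∀ x → x <ᴿ fromℚ M → ∃ λ i → x <ᴿ b i
  -- `sup-approached-from` divides by x₀, so a negative `g` is first raised above 0.
  sup-approached x (g , Ug , g<M) with g ℚ.<? 0ℚᵘ
  ... | yes g<0 = let (x₀ , 0<x₀ , x₀<M) = ℚ.<-dense 0<M in sup-approached-from {x} Ug (ℚ.<-trans g<0 0<x₀) 0<x₀ x₀<M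
  ... | no  g≮0 = let (x₀ , g<x₀ , x₀<M) = ℚ.<-dense g<M in sup-approached-from {x} Ug g<x₀ (ℚ.≤-<-trans (ℚ.≮⇒≥ g≮0) g<x₀) x₀<M

theorem5 : (q r p : ℕ) (2≤q : 2 ≤ q) (r<q : r < q) (q+r<p : q + r < p) →
    let A = residues q r p
        s = ∣ A ∣
        b = bSeq A (2≤∣residues∣ 2≤q q+r<p)
        instance p∸1≢0 = p∸1-nonZero 2≤q q+r<p
    in IsInfimum b (fromℚ (+ (q * (s ∸ 1) + r) / (p ∸ 1)))
     × IsSupremum b (fromℚ (+ (q * (p ∸ 1) + p * r) / (p ∸ 1)))
theorem5 q r zero           2≤q r<q ()
theorem5 q r (suc zero)     2≤q r<q q+r<1 = contradiction (ℕ.≤-trans 2≤q (ℕ.≤-trans (ℕ.m≤m+n q r) (s≤s⁻¹ q+r<1))) λ ()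
-- With `p` a double successor, `p ∸ 1` is a successor and the fractions in the statement reduce to
-- `m` and `M`.
theorem5 q r (suc (suc P-1)) 2≤q r<q q+r<p =
  ((λ (n , 1≤n) → m≤b n 1≤n) , inf-approached) , ((λ (n , 1≤n) → b≤M n 1≤n) , sup-approached)
  where open Residues q r P-1 2≤q r<q q+r<p
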